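{- For any integer $k\geq 1$ and any $k$-regular graph $G$, $\chi_2(G)-\chi(G)\leq 6\ln k+2$.
   Context: Graphs are finite and simple. $\chi(G)$ denotes the chromatic number of $G$. A dynamic $l$-coloring of $G$ is a proper vertex coloring of $G$ with colors in $\{1,\ldots,l\}$ such that for every vertex $v$ of degree at least $2$, at least two different colors appear on the neighbors of $v$. The dynamic chromatic number $\chi_2(G)$ is the smallest integer $l$ such that $G$ has a dynamic $l$-coloring. $\ln$ is the natural logarithm. -}

module Defs where

open import Data.Fin.Base using (Fin; finToFun; funToFin)
open import Data.Fin.Properties using (any?; all?; finToFun-funToFin) renaming (_≟_ to _≟ᶠ_)
open import Data.Integer.Base as ℤ using (ℤ; +_)
import Data.Integer.Properties as ℤ
open import Data.List.Base using (List; []; _∷_; allFin; filter; length)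
open import Data.List.Membership.Propositional using (_∈_)
open import Data.List.Membership.Propositional.Properties using (∈-filter⁻)
open import Data.List.Relation.Unary.All using (_∷_)
open import Data.List.Relation.Unary.AllPairs using (_∷_)
open import Data.List.Relation.Unary.Any using (here; there)
open import Data.List.Relation.Unary.Unique.Propositional using (Unique)
open import Data.List.Relation.Unary.Unique.Propositional.Properties using (allFin⁺; filter⁺)
open import Data.Nat.Base as ℕ using (ℕ; zero; suc)
import Data.Nat.Properties as ℕ
open import Data.Product.Base using (∃; ∃-syntax; ∃₂; _×_; _,_; proj₁; proj₂)
open import Data.Rational.Base
open import Data.Rational.Properties
open import Data.Rational.Solver using (module +-*-Solver)
import Data.Rational.Unnormalised.Base as ℚᵘ
import Data.Rational.Unnormalised.Properties as ℚᵘ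
open import Data.Sum.Base using (inj₁; inj₂)
open import Function.Base using (id; _∘_)
open import Level using (0ℓ)
open import Relation.Binary.Core using (Rel)
open import Relation.Binary.Definitions using (Decidable; Irreflexive; Symmetric)
open import Relation.Binary.PropositionalEquality
open import Relation.Nullary using (Dec; yes; no; contradiction; ¬?; _×-dec_; _→-dec_)
open import Relation.Nullary.Decidable using (map′)
import Relation.Unary as U

record Graph (n : ℕ) : Set₁ where
  infix 4 _~_ _~?_
  field
    _~_    : Rel (Fin n) 0ℓ
    _~?_   : Decidable _~_
    sym-~  : Symmetric _~_
    irrefl : Irreflexive _≡_ _~_

  neighbors : Fin n → List (Fin n)
  neighbors v = filter (v ~?_) (allFin n)

  degree : Fin n → ℕ
  degree v = length (neighbors v)

module _ {n : ℕ} (G : Graph n) where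
  open Graph G

  Regular : ℕ → Set
  Regular k = ∀ v → degree v ≡ k

  Proper : ∀ {l} → (Fin n → Fin l) → Set
  Proper c = ∀ u v → u ~ v → c u ≢ c v

  Dynamic : ∀ {l} → (Fin n → Fin l) → Set
  Dynamic c = Proper c ×
    (∀ v → 2 ℕ.≤ degree v → ∃₂ λ u w → v ~ u × v ~ w × c u ≢ c w)

  Colorable : ℕ → Set
  Colorable l = ∃ λ (c : Fin n → Fin l) → Proper c

  DynamicColorable : ℕ → Set
  DynamicColorable l = ∃ λ (c : Fin n → Fin l) → Dynamic c

Minimum : (ℕ → Set) → ℕ → Set
Minimum P m = P m × (∀ l → P l → m ℕ.≤ l)

minimum : {P : ℕ → Set} → U.Decidable P → ∀ m → P m → ∃ (Minimum P)
minimum         P? zero    p = zero , p , λ _ _ → ℕ.z≤n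
minimum {P = P} P? (suc m) p with P? zero
... | yes p₀ = zero , p₀ , λ _ _ → ℕ.z≤n
... | no ¬p₀ with minimum {P = P ∘ suc} (P? ∘ suc) m p
...   | l , pl , least = suc l , pl , λ where
          zero    p₀ → contradiction p₀ ¬p₀
          (suc j) pj → ℕ.s≤s (least j pj)

module _ {n : ℕ} (G : Graph n) where
  open Graph G

  proper? : ∀ {l} (c : Fin n → Fin l) → Dec (Proper G c)
  proper? c = all? λ u → all? λ v → (u ~? v) →-dec ¬? (c u ≟ᶠ c v)

  dynamic? : ∀ {l} (c : Fin n → Fin l) → Dec (Dynamic G c)
  dynamic? c = proper? c ×-dec
    (all? λ v → (2 ℕ.≤? degree v) →-dec
      (any? λ u → any? λ w → (v ~? u) ×-dec (v ~? w) ×-dec ¬? (c u ≟ᶠ c w)))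

  proper-resp : ∀ {l} {c d : Fin n → Fin l} → c ≗ d → Proper G c → Proper G d
  proper-resp c≗d p u v u~v du≡dv =
    p u v u~v (trans (c≗d u) (trans du≡dv (sym (c≗d v))))

  dynamic-resp : ∀ {l} {c d : Fin n → Fin l} → c ≗ d → Dynamic G c → Dynamic G d
  dynamic-resp c≗d (p , q) = proper-resp c≗d p , λ v 2≤d →
    let u , w , v~u , v~w , cu≢cw = q v 2≤d in
    u , w , v~u , v~w , λ du≡dw →
      cu≢cw (trans (c≗d u) (trans du≡dw (sym (c≗d w))))

  ∃-coloring? : ∀ {l} {P : (Fin n → Fin l) → Set} → U.Decidable P →
                (∀ {c d} → c ≗ d → P c → P d) → Dec (∃ P)
  ∃-coloring? P? resp = map′
    (λ (i , p) → finToFun i , p)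
    (λ (c , p) → funToFin c , resp (λ v → sym (finToFun-funToFin c v)) p)
    (any? (P? ∘ finToFun))

  colorable? : U.Decidable (Colorable G)
  colorable? l = ∃-coloring? proper? proper-resp

  dynamicColorable? : U.Decidable (DynamicColorable G)
  dynamicColorable? l = ∃-coloring? dynamic? dynamic-resp

  id-proper : Proper G id
  id-proper u v u~v u≡v = irrefl u≡v u~v

  two-elements : (xs : List (Fin n)) → Unique xs → 2 ℕ.≤ length xs →
                 ∃₂ λ u w → u ∈ xs × w ∈ xs × u ≢ w
  two-elements (u ∷ w ∷ _) ((u≢w ∷ _) ∷ _) _ =
    u , w , here refl , there (here refl) , u≢w
  two-elements (_ ∷ []) _ (ℕ.s≤s ())

  id-dynamic : Dynamic G id
  id-dynamic = id-proper , λ v 2≤d →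
    let u , w , u∈ , w∈ , u≢w = two-elements (neighbors v) (filter⁺ (v ~?_) (allFin⁺ n)) 2≤d in
    u , w , proj₂ (∈-filter⁻ (v ~?_) {xs = allFin n} u∈)
          , proj₂ (∈-filter⁻ (v ~?_) {xs = allFin n} w∈) , u≢w

  χ-minimum : ∃ (Minimum (Colorable G))
  χ-minimum = minimum colorable? n (id , id-proper)

  χ₂-minimum : ∃ (Minimum (DynamicColorable G))
  χ₂-minimum = minimum dynamicColorable? n (id , id-dynamic)

  χ : ℕ
  χ = proj₁ χ-minimum

  χ₂ : ℕ
  χ₂ = proj₁ χ₂-minimum

record ℝ : Set where
  field
    seq    : ℕ → ℚ
    cauchy : ∀ ε → 0ℚ < ε →
             ∃[ N ] (∀ m n → N ℕ.≤ m → N ℕ.≤ n → ∣ seq m - seq n ∣ < ε)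

open ℝ public

-- Order of the limits, so two sequences with the same limit are each ≤ᴿ the other.
infix 4 _≤ᴿ_

_≤ᴿ_ : ℝ → ℝ → Set
x ≤ᴿ y = ∀ ε → 0ℚ < ε → ∃[ N ] (∀ n → N ℕ.≤ n → seq x n < seq y n + ε)

fromℚ : ℚ → ℝ
fromℚ q .seq _ = q
fromℚ q .cauchy ε 0<ε = 0 , λ _ _ _ _ →
  subst (λ r → ∣ r ∣ < ε) (sym (+-inverseʳ q)) 0<ε

fromℤ : ℤ → ℝ
fromℤ z = fromℚ (z / 1)

halve : ∀ {ε} → 0ℚ < ε → 0ℚ < ½ * ε
halve {ε} 0<ε = positive⁻¹ (½ * ε) {{pos*pos⇒pos ½ ε {{positive 0<ε}}}}

½+½ : ∀ ε → ½ * ε + ½ * ε ≡ ε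
½+½ ε = trans (sym (*-distribʳ-+ ε ½ ½)) (*-identityˡ ε)

+-interchange : ∀ a b c d → (a + b) - (c + d) ≡ (a - c) + (b - d)
+-interchange = solve 4 (λ a b c d → (a :+ b) :- (c :+ d) := (a :- c) :+ (b :- d)) refl
  where open +-*-Solver

infixl 6 _+ᴿ_

_+ᴿ_ : ℝ → ℝ → ℝ
(x +ᴿ y) .seq n = seq x n + seq y n
(x +ᴿ y) .cauchy ε 0<ε =
  let N₁ , h₁ = cauchy x (½ * ε) (halve 0<ε)
      N₂ , h₂ = cauchy y (½ * ε) (halve 0<ε)
  in N₁ ℕ.⊔ N₂ , λ m n N≤m N≤n → begin-strict
    ∣ (seq x m + seq y m) - (seq x n + seq y n) ∣
      ≡⟨ cong ∣_∣ (+-interchange (seq x m) (seq y m) (seq x n) (seq y n)) ⟩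
    ∣ (seq x m - seq x n) + (seq y m - seq y n) ∣
      ≤⟨ ∣p+q∣≤∣p∣+∣q∣ (seq x m - seq x n) (seq y m - seq y n) ⟩
    ∣ seq x m - seq x n ∣ + ∣ seq y m - seq y n ∣
      <⟨ +-mono-< (h₁ m n (ℕ.m⊔n≤o⇒m≤o N₁ N₂ N≤m) (ℕ.m⊔n≤o⇒m≤o N₁ N₂ N≤n))
                  (h₂ m n (ℕ.m⊔n≤o⇒n≤o N₁ N₂ N≤m) (ℕ.m⊔n≤o⇒n≤o N₁ N₂ N≤n)) ⟩
    ½ * ε + ½ * ε
      ≡⟨ ½+½ ε ⟩
    ε ∎
  where open ≤-Reasoning

infixl 7 _·_

_·_ : ℕ → ℝ → ℝ
zero  · x = fromℚ 0ℚ
suc m · x = x +ᴿ m · x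

-- reciprocals a m = 1/(a+1) + ⋯ + 1/(a+m)
reciprocals : ℕ → ℕ → ℚ
reciprocals a zero    = 0ℚ
reciprocals a (suc m) = + 1 / suc a + reciprocals (suc a) m

-- The right-endpoint Riemann sum of 1/t over [1,k] with mesh 1/N is
-- ∑_{i=1}^{(k-1)N} (1/N) · 1/(1 + i/N) = ∑_{i=1}^{(k-1)N} 1/(N+i).
riemann : ℕ → (N : ℕ) .{{_ : ℕ.NonZero N}} → ℚ
riemann k N = reciprocals N (ℕ.pred k ℕ.* N)

1/-antitone : ∀ {a b} → a ℕ.≤ b → + 1 / suc b ≤ + 1 / suc a
1/-antitone {a} {b} a≤b = toℚᵘ-cancel-≤ (begin
  toℚᵘ (+ 1 / suc b)  ≃⟨ toℚᵘ-fromℚᵘ (ℚᵘ.mkℚᵘ (+ 1) b) ⟩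
  ℚᵘ.mkℚᵘ (+ 1) b     ≤⟨ ℚᵘ.*≤* (ℤ.*-monoˡ-≤-nonNeg (+ 1) (ℤ.+≤+ (ℕ.s≤s a≤b))) ⟩
  ℚᵘ.mkℚᵘ (+ 1) a     ≃⟨ toℚᵘ-fromℚᵘ (ℚᵘ.mkℚᵘ (+ 1) a) ⟨
  toℚᵘ (+ 1 / suc a)  ∎)
  where open ℚᵘ.≤-Reasoning

0≤1/ : ∀ a → 0ℚ ≤ + 1 / suc a
0≤1/ a = nonNegative⁻¹ (+ 1 / suc a) {{normalize-nonNeg 1 (suc a)}}

multiple : ℕ → ℚ → ℚ
multiple zero    q = 0ℚ
multiple (suc m) q = q + multiple m q

multiple-mkℚᵘ : ∀ m d → toℚᵘ (multiple m (+ 1 / suc d)) ℚᵘ.≃ ℚᵘ.mkℚᵘ (+ m) d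
multiple-mkℚᵘ zero    d = ℚᵘ.*≡* refl
multiple-mkℚᵘ (suc m) d = begin-equality
  toℚᵘ (+ 1 / suc d + multiple m (+ 1 / suc d))
    ≃⟨ toℚᵘ-homo-+ (+ 1 / suc d) (multiple m (+ 1 / suc d)) ⟩
  toℚᵘ (+ 1 / suc d) ℚᵘ.+ toℚᵘ (multiple m (+ 1 / suc d))
    ≃⟨ ℚᵘ.+-cong (toℚᵘ-fromℚᵘ (ℚᵘ.mkℚᵘ (+ 1) d)) (multiple-mkℚᵘ m d) ⟩
  ℚᵘ.mkℚᵘ (+ 1) d ℚᵘ.+ ℚᵘ.mkℚᵘ (+ m) d
    ≃⟨ ℚᵘ.*≡* (trans (cong (ℤ._* + suc d) (cong (ℤ._+ + m ℤ.* + suc d) (ℤ.*-identityˡ (+ suc d))))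
                (trans (cong (ℤ._* + suc d) (sym (ℤ.suc-* (+ m) (+ suc d))))
                  (ℤ.*-assoc (+ suc m) (+ suc d) (+ suc d)))) ⟩
  ℚᵘ.mkℚᵘ (+ suc m) d ∎
  where open ℚᵘ.≤-Reasoning

multiple-1/ : ∀ j m .{{_ : ℕ.NonZero m}} →
              multiple m (+ 1 / suc (ℕ.pred (suc j ℕ.* m))) ≡ + 1 / suc j
multiple-1/ j m@(suc m-1) = toℚᵘ-injective (begin-equality
  toℚᵘ (multiple m (+ 1 / (suc j ℕ.* m)))     ≃⟨ multiple-mkℚᵘ m (ℕ.pred (suc j ℕ.* m)) ⟩
  ℚᵘ.mkℚᵘ (+ m) (ℕ.pred (suc j ℕ.* m))        ≃⟨ ℚᵘ.*≡* (cong +_ eq) ⟩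
  ℚᵘ.mkℚᵘ (+ 1) j                             ≃⟨ toℚᵘ-fromℚᵘ (ℚᵘ.mkℚᵘ (+ 1) j) ⟨
  toℚᵘ (+ 1 / suc j)                          ∎)
  where
  open ℚᵘ.≤-Reasoning
  eq : m ℕ.* suc j ≡ 1 ℕ.* (suc j ℕ.* m)
  eq = trans (ℕ.*-comm m (suc j)) (sym (ℕ.*-identityˡ (suc j ℕ.* m)))

reciprocals-+ : ∀ a m n → reciprocals a (m ℕ.+ n) ≡ reciprocals a m + reciprocals (a ℕ.+ m) n
reciprocals-+ a zero    n rewrite ℕ.+-identityʳ a = sym (+-identityˡ (reciprocals a n))
reciprocals-+ a (suc m) n rewrite ℕ.+-suc a m =
  trans (cong (λ r → + 1 / suc a + r) (reciprocals-+ (suc a) m n)) (sym (+-assoc (+ 1 / suc a) _ _))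

reciprocals-lower : ∀ a m d → a ℕ.+ m ℕ.≤ suc d → multiple m (+ 1 / suc d) ≤ reciprocals a m
reciprocals-lower a zero    d _ = ≤-refl
reciprocals-lower a (suc m) d h rewrite ℕ.+-suc a m =
  +-mono-≤ (1/-antitone (ℕ.≤-trans (ℕ.m≤m+n a m) (ℕ.s≤s⁻¹ h)))
           (reciprocals-lower (suc a) m d h)

reciprocals-upper : ∀ a m d → d ℕ.≤ a → reciprocals a m ≤ multiple m (+ 1 / suc d)
reciprocals-upper a zero    d _ = ≤-refl
reciprocals-upper a (suc m) d h =
  +-mono-≤ (1/-antitone h) (reciprocals-upper (suc a) m d (ℕ.m≤n⇒m≤1+n h))

-- Refining the mesh by a factor m increases the lower sums …
refine-lower : ∀ a p m .{{_ : ℕ.NonZero m}} → reciprocals a p ≤ reciprocals (a ℕ.* m) (p ℕ.* m)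
refine-lower a zero    m = ≤-refl
refine-lower a (suc p) m@(suc m-1) = begin
  + 1 / suc a + reciprocals (suc a) p
    ≡⟨ cong (λ r → r + reciprocals (suc a) p) (multiple-1/ a m) ⟨
  multiple m (+ 1 / (suc a ℕ.* m)) + reciprocals (suc a) p
    ≤⟨ +-mono-≤ (reciprocals-lower (a ℕ.* m) m (ℕ.pred (suc a ℕ.* m)) (ℕ.≤-reflexive (ℕ.+-comm (a ℕ.* m) m)))
                (refine-lower (suc a) p m) ⟩
  reciprocals (a ℕ.* m) m + reciprocals (suc a ℕ.* m) (p ℕ.* m)
    ≡⟨ cong (λ b → reciprocals (a ℕ.* m) m + reciprocals b (p ℕ.* m)) (ℕ.+-comm m (a ℕ.* m)) ⟩
  reciprocals (a ℕ.* m) m + reciprocals (a ℕ.* m ℕ.+ m) (p ℕ.* m)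
    ≡⟨ reciprocals-+ (a ℕ.* m) m (p ℕ.* m) ⟨
  reciprocals (a ℕ.* m) (m ℕ.+ p ℕ.* m) ∎
  where open ≤-Reasoning

-- … and keeps them below the upper sums.
refine-upper : ∀ a p m .{{_ : ℕ.NonZero m}} →
               reciprocals (suc a ℕ.* m) (p ℕ.* m) ≤ reciprocals a p
refine-upper a zero    m = ≤-refl
refine-upper a (suc p) m@(suc m-1) = begin
  reciprocals (suc a ℕ.* m) (m ℕ.+ p ℕ.* m)
    ≡⟨ reciprocals-+ (suc a ℕ.* m) m (p ℕ.* m) ⟩
  reciprocals (suc a ℕ.* m) m + reciprocals (suc a ℕ.* m ℕ.+ m) (p ℕ.* m)
    ≡⟨ cong (λ b → reciprocals (suc a ℕ.* m) m + reciprocals b (p ℕ.* m)) (ℕ.+-comm (suc a ℕ.* m) m) ⟩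
  reciprocals (suc a ℕ.* m) m + reciprocals (suc (suc a) ℕ.* m) (p ℕ.* m)
    ≤⟨ +-mono-≤ (reciprocals-upper (suc a ℕ.* m) m (ℕ.pred (suc a ℕ.* m)) (ℕ.n≤1+n _))
                (refine-upper (suc a) p m) ⟩
  multiple m (+ 1 / (suc a ℕ.* m)) + reciprocals (suc a) p
    ≡⟨ cong (λ r → r + reciprocals (suc a) p) (multiple-1/ a m) ⟩
  + 1 / suc a + reciprocals (suc a) p ∎
  where open ≤-Reasoning

reciprocals-snoc : ∀ a m → reciprocals a m ≤ reciprocals a (suc m)
reciprocals-snoc a zero    = ≤-trans (0≤1/ a) (≤-reflexive (sym (+-identityʳ (+ 1 / suc a))))
reciprocals-snoc a (suc m) = +-monoʳ-≤ (+ 1 / suc a) (reciprocals-snoc (suc a) m)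

riemann-compare : ∀ k m n → riemann k (suc m) ≤ + 1 / suc n + riemann k (suc n)
riemann-compare k m n = begin
  reciprocals (suc m) (p ℕ.* suc m)
    ≤⟨ refine-lower (suc m) (p ℕ.* suc m) (suc n) ⟩
  reciprocals (suc m ℕ.* suc n) (p ℕ.* suc m ℕ.* suc n)
    ≡⟨ cong₂ reciprocals (ℕ.*-comm (suc m) (suc n)) eq ⟩
  reciprocals (suc n ℕ.* suc m) (p ℕ.* suc n ℕ.* suc m)
    ≤⟨ refine-upper n (p ℕ.* suc n) (suc m) ⟩
  reciprocals n (p ℕ.* suc n)
    ≤⟨ reciprocals-snoc n (p ℕ.* suc n) ⟩
  + 1 / suc n + reciprocals (suc n) (p ℕ.* suc n) ∎
  where
  open ≤-Reasoning
  p = ℕ.pred k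
  eq : p ℕ.* suc m ℕ.* suc n ≡ p ℕ.* suc n ℕ.* suc m
  eq = trans (ℕ.*-assoc p (suc m) (suc n))
         (trans (cong (p ℕ.*_) (ℕ.*-comm (suc m) (suc n)))
           (sym (ℕ.*-assoc p (suc n) (suc m))))

archimedean : ∀ ε → 0ℚ < ε → ∃[ N ] (+ 1 / suc N < ε)
archimedean ε@(mkℚ (+ zero) _ _)      0<ε = contradiction (positive 0<ε) λ ()
archimedean ε@(mkℚ ℤ.-[1+ _ ] _ _)    0<ε = contradiction (positive 0<ε) λ ()
archimedean ε@(mkℚ (+ suc a) d _) 0<ε = suc d , toℚᵘ-cancel-< (begin-strict
  toℚᵘ (+ 1 / suc (suc d))   ≃⟨ toℚᵘ-fromℚᵘ (ℚᵘ.mkℚᵘ (+ 1) (suc d)) ⟩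
  ℚᵘ.mkℚᵘ (+ 1) (suc d)      <⟨ ℚᵘ.*<* (ℤ.+<+ lt) ⟩
  toℚᵘ ε                     ∎)
  where
  open ℚᵘ.≤-Reasoning
  lt : 1 ℕ.* suc d ℕ.< suc a ℕ.* suc (suc d)
  lt = ℕ.<-≤-trans (ℕ.≤-reflexive (cong suc (ℕ.*-identityˡ (suc d))))
                   (ℕ.m≤m+n (suc (suc d)) (a ℕ.* suc (suc d)))

∣-∣-<⁺ : ∀ {p q ε} → p < ε + q → q < ε + p → ∣ p - q ∣ < ε
∣-∣-<⁺ {p} {q} {ε} p<ε+q q<ε+p with ∣p∣≡p∨∣p∣≡-p (p - q)
... | inj₁ eq = subst₂ _<_ (sym eq) (cancel ε q) (+-monoˡ-< (- q) p<ε+q)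
  where
  open +-*-Solver
  cancel : ∀ ε q → (ε + q) - q ≡ ε
  cancel = solve 2 (λ ε q → (ε :+ q) :- q := ε) refl
... | inj₂ eq = subst₂ _<_ (trans (flip p q) (sym eq)) (cancel ε p) (+-monoˡ-< (- p) q<ε+p)
  where
  open +-*-Solver
  cancel : ∀ ε q → (ε + q) - q ≡ ε
  cancel = solve 2 (λ ε q → (ε :+ q) :- q := ε) refl
  flip : ∀ p q → q - p ≡ - (p - q)
  flip = solve 2 (λ p q → q :- p := :- (p :- q)) refl

-- ln k = ∫₁ᵏ dt/t as the limit of the Riemann sums of mesh 1/(n+1).
ln : (k : ℕ) .{{_ : ℕ.NonZero k}} → ℝ
ln k .seq n = riemann k (suc n)
ln k .cauchy ε 0<ε =
  let N , 1/N<ε = archimedean ε 0<ε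
      close : ∀ m n → N ℕ.≤ n → riemann k (suc m) < ε + riemann k (suc n)
      close m n N≤n = ≤-<-trans (riemann-compare k m n)
        (+-monoˡ-< (riemann k (suc n)) (≤-<-trans (1/-antitone N≤n) 1/N<ε))
  in N , λ m n N≤m N≤n → ∣-∣-<⁺ (close m n N≤n) (close n m N≤m)

{-# OPTIONS --safe #-}
module Submission where

-- Fix a proper coloring c of the k-regular graph G with χ(G) colors.  Suppose a
-- set T of vertices meets every neighborhood, contains no neighborhood, and
-- induces a subgraph with a proper coloring φ in s colors.  Recoloring T by φ
-- with s new colors keeps the coloring proper, and every vertex then has one
-- neighbor with an old color and one with a new color.  So the dynamic
-- chromatic number is at most χ(G) + s (module InOut), and such a T is needed
-- for some s ≤ 6 ln k + 2.
--
-- T is found by Rosenfeld's counting argument, an elementary substitute for the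
-- Lovász local lemma.  Vertices are labeled in or out with weights a and b, and
-- a labeling is good on a set p of vertices if the requirements on T hold as far
-- as p is concerned: neighborhoods inside p are neither all in nor all out, and
-- the vertices of p that are in can be properly colored with s colors.  By
-- induction on p, one more vertex x multiplies the weight of the good labelings
-- by at least β.  Out of the factor a + b only those labelings are lost that
-- become defective at x: either the neighborhood of one of the k neighbors of x
-- is all in or all out, or x and s of its neighbors are in (otherwise the
-- coloring φ extends greedily to x).  A defect prescribing the labels of m
-- vertices besides x is paid for by forgetting these m labels, which by
-- induction divides the weight by at least β ^ m.  Therefore it suffices that
--   β + k b^k / β^(k-1) + k a^k / β^(k-1) + C(k,s) a^(s+1) / β^s ≤ a + b.
-- Because s-colorability is demanded, and not a bound on the degrees in T, the
-- last term counts only stars centered at x; this saving leaves room for the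
-- constant 6 also at moderate k.
--
-- The logarithm enters through the largest m with (13/11)^m ≤ k, since ln (13/11)
-- slightly exceeds 1/6: then m ≤ 6 ln k (log-≤-riemann), and s = m + 2 is allowed.
-- With k a / b equal to 11 s / 30 and s large, the second term is governed by
-- k^2 e^(-k a / b), small because k^2 is about e^(s/3), and the last one by
-- (k a / b)^s / s!, small because 30/11 exceeds e.  Module Asymptotic makes this
-- precise for s ≥ 58; for 19 ≤ s < 58 the degree k lies in an explicit interval,
-- and monotonicity in k leaves a computation at its endpoints (module Range).
--
-- If k ≤ 18, the same counting argument yields a dynamic coloring with k + 3
-- colors (k + 4 if k ≤ 3) directly (module FewColors); as χ(G) ≥ 2, this is enough.
-- If k = 1, there is no vertex of degree 2 and every proper coloring is dynamic.

open import Defs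
open import Algebra.Properties.Semiring.Sum as SemiringSum using ()
open import Data.Bool.Base using (Bool; true; T; _∧_; if_then_else_)
open import Data.Bool.Properties using (T-∧)
open import Data.Fin.Base using (Fin; zero; suc; toℕ; _↑ˡ_; _↑ʳ_; splitAt)
open import Data.Fin.Properties
  using (any?; all?; pigeonhole; <⇒≢; suc-injective; ↑ˡ-injective; ↑ʳ-injective; splitAt-↑ˡ; splitAt-↑ʳ)
  renaming (_≟_ to _≟ᶠ_)
open import Data.Fin.Subset using (Subset; inside; outside; _∈_; _∉_; _⊆_; ⊥; ⊤; ∣_∣)
  renaming (_-_ to _∖_)
open import Data.Fin.Subset.Properties
  using (p─q⊆p; x∈p∧x≢y⇒x∈p-y; x∈p⇒∣p-x∣<∣p∣; Empty-unique; nonempty?; _∈?_; ∉⊥; ∈⊤)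
open import Data.Integer.Base as ℤ using (+_; _-_)
import Data.Integer.Properties as ℤ
open import Data.List.Base using (List; []; _∷_; length; foldl; map; filter; _++_; allFin)
  renaming (lookup to lookupˡ)
open import Data.List.Membership.DecPropositional using () renaming (_∈?_ to dec-∈)
open import Data.List.Membership.Propositional using (mapWith∈; find) renaming (_∈_ to _∈ˡ_)
open import Data.List.Membership.Propositional.Properties using (∈-filter⁺; ∈-filter⁻; ∈-allFin; ∈-map⁺)
open import Data.List.Membership.Setoid.Properties using (length-mapWith∈)
open import Data.List.Properties using (length-map; length-++; filter-all)
open import Data.List.Relation.Binary.Sublist.Propositional using ([]; _∷_; _∷ʳ_)
  renaming (minimum to []⊆_; _⊆_ to _⊆ˡ_)
open import Data.List.Relation.Binary.Sublist.Propositional.Properties using (All-resp-⊆)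
open import Data.List.Relation.Unary.All as All using (All; []; _∷_)
import Data.List.Relation.Unary.All.Properties as All
open import Data.List.Relation.Unary.AllPairs using ([]; _∷_)
open import Data.List.Relation.Unary.Any as Any using (Any; here; there; index)
import Data.List.Relation.Unary.Any.Properties as Any
open import Data.List.Relation.Unary.Unique.Propositional using (Unique)
open import Data.List.Relation.Unary.Unique.Propositional.Properties using (allFin⁺; filter⁺)
open import Data.Nat.Base as ℕ hiding (∣_-_∣; _/_)
open import Data.Nat.Combinatorics.Base using (_P′_)
open import Data.Nat.DivMod using (/-monoˡ-≤; m*n/n≡m)
open import Data.Nat.Induction using (<-wellFounded)
open import Data.Nat.ListAction using () renaming (sum to sumˡ)
open import Data.Nat.Properties hiding (<⇒≢; suc-injective)
open import Data.Nat.Tactic.RingSolver using (solve-∀)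
open import Data.Product.Base using (∃; ∃₂; _×_; _,_; proj₁; proj₂)
open import Data.Rational.Base as ℚ using (0ℚ; 1ℚ; _/_; toℚᵘ)
import Data.Rational.Properties as ℚ
open import Data.Rational.Solver using (module +-*-Solver)
import Data.Rational.Unnormalised.Base as ℚᵘ
import Data.Rational.Unnormalised.Properties as ℚᵘ
open import Data.Sum.Base using (_⊎_; inj₁; inj₂; [_,_]′)
open import Data.Vec.Base using (Vec; []; _∷_; lookup; _[_]≔_; replicate; here; there)
open import Data.Vec.Properties using ([]≔-lookup; []≔-idempotent; lookup∘update; lookup∘update′)
open import Function.Base using (id; _∘_; case_of_)
open import Function.Bundles using (Equivalence)
open import Induction.WellFounded using (Acc; acc)
open import Relation.Binary.PropositionalEquality
open import Relation.Nullary using (Dec; yes; no; ¬_; contradiction; ¬?; _×-dec_; _→-dec_)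
open import Relation.Nullary.Decidable using (decidable-stable; map′; toWitness)
open import Relation.Unary using (Decidable)

open SemiringSum +-*-semiring using (sum; sum-cong-≗; ∑-distrib-+; ∑-comm; *-distribˡ-sum; sum-replicate-zero)

-- Counting labelings

-- The indicator of a decidable proposition.
𝟙 : ∀ {ℓ} {P : Set ℓ} → Dec P → ℕ
𝟙 (yes _) = 1
𝟙 (no _)  = 0

𝟙-mono : ∀ {ℓ₁ ℓ₂} {P : Set ℓ₁} {Q : Set ℓ₂} → (P → Q) → (P? : Dec P) (Q? : Dec Q) → 𝟙 P? ≤ 𝟙 Q?
𝟙-mono P⇒Q (no _)  _       = z≤n
𝟙-mono P⇒Q (yes _) (yes _) = ≤-refl
𝟙-mono P⇒Q (yes p) (no ¬q) = contradiction (P⇒Q p) ¬q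

𝟙-cover : ∀ {ℓ₁ ℓ₂ ℓ₃} {P : Set ℓ₁} {Q : Set ℓ₂} {R : Set ℓ₃} → (P → Q ⊎ R) → 
          (P? : Dec P) (Q? : Dec Q) (R? : Dec R) → 𝟙 P? ≤ 𝟙 Q? + 𝟙 R?
𝟙-cover P⇒Q⊎R (no _)  _       _       = z≤n
𝟙-cover P⇒Q⊎R (yes _) (yes _) _       = s≤s z≤n
𝟙-cover P⇒Q⊎R (yes p) (no ¬q) (yes _) = ≤-refl
𝟙-cover P⇒Q⊎R (yes p) (no ¬q) (no ¬r) with P⇒Q⊎R p
... | inj₁ q = contradiction q ¬q
... | inj₂ r = contradiction r ¬r

sum-mono : ∀ {m} {s t : Fin m → ℕ} → (∀ i → s i ≤ t i) → sum s ≤ sum t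
sum-mono {zero}  s≤t = z≤n
sum-mono {suc m} s≤t = +-mono-≤ (s≤t zero) (sum-mono (s≤t ∘ suc))

sum-const : ∀ m c → sum {m} (λ _ → c) ≡ m * c
sum-const zero    c = refl
sum-const (suc m) c = cong (λ z → c + z) (sum-const m c)

module _ {L : ℕ} where

  -- The sum of a weight over all labelings of n vertices by L labels.
  total : ∀ {n} → (Vec (Fin L) n → ℕ) → ℕ
  total {zero}  F = F []
  total {suc n} F = sum λ l → total λ f → F (l ∷ f)

  total-mono : ∀ {n} {F G : Vec (Fin L) n → ℕ} → (∀ f → F f ≤ G f) → total F ≤ total G
  total-mono {zero}  F≤G = F≤G []
  total-mono {suc n} F≤G = sum-mono λ l → total-mono λ f → F≤G (l ∷ f)

  total-+ : ∀ {n} (F G : Vec (Fin L) n → ℕ) → total (λ f → F f + G f) ≡ total F + total G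
  total-+ {zero}  F G = refl
  total-+ {suc n} F G = trans
    (sum-cong-≗ λ l → total-+ (λ f → F (l ∷ f)) (λ f → G (l ∷ f)))
    (∑-distrib-+ (λ l → total λ f → F (l ∷ f)) (λ l → total λ f → G (l ∷ f)))

  total-* : ∀ {n} c (F : Vec (Fin L) n → ℕ) → total (λ f → c * F f) ≡ c * total F
  total-* {zero}  c F = refl
  total-* {suc n} c F = trans
    (sum-cong-≗ λ l → total-* c (λ f → F (l ∷ f)))
    (sym (*-distribˡ-sum c λ l → total λ f → F (l ∷ f)))

  total-sum : ∀ {n m} (F : Fin m → Vec (Fin L) n → ℕ) →
              total (λ f → sum λ i → F i f) ≡ sum λ i → total (F i)
  total-sum {zero}  F = refl
  total-sum {suc n} {m} F = trans
    (sum-cong-≗ λ l → total-sum (λ i f → F i (l ∷ f)))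
    (∑-comm {L} {m} (λ l i → total λ f → F i (l ∷ f)))

  -- Replacing the label of x by each of the L labels in turn produces every
  -- labeling L times.
  resample : ∀ {n} (x : Fin n) (F : Vec (Fin L) n → ℕ) →
             L * total F ≡ total λ f → sum λ l → F (f [ x ]≔ l)
  resample {suc n} zero F = begin
    L * total F
      ≡⟨ sum-const L (total F) ⟨
    sum {L} (λ _ → sum λ l → total λ f → F (l ∷ f))
      ≡⟨ sum-cong-≗ {L} (λ _ → total-sum (λ l f → F (l ∷ f))) ⟨
    sum {L} (λ _ → total λ f → sum λ l → F (l ∷ f)) ∎
    where open ≡-Reasoning
  resample {suc n} (suc x) F = trans
    (*-distribˡ-sum L (λ l → total λ f → F (l ∷ f)))
    (sum-cong-≗ λ l → resample x λ f → F (l ∷ f))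

  -- The number of labelings satisfying P.
  count : ∀ {n ℓ} {P : Vec (Fin L) n → Set ℓ} → Decidable P → ℕ
  count P? = total λ f → 𝟙 (P? f)

  count-mono : ∀ {n ℓ₁ ℓ₂} {P : Vec (Fin L) n → Set ℓ₁} {Q : Vec (Fin L) n → Set ℓ₂}
               (P? : Decidable P) (Q? : Decidable Q) → (∀ {f} → P f → Q f) → count P? ≤ count Q?
  count-mono P? Q? P⇒Q = total-mono λ f → 𝟙-mono P⇒Q (P? f) (Q? f)

  count-cover : ∀ {n ℓ₁ ℓ₂ ℓ₃} {P : Vec (Fin L) n → Set ℓ₁} {Q : Vec (Fin L) n → Set ℓ₂} {R : Vec (Fin L) n → Set ℓ₃}
                (P? : Decidable P) (Q? : Decidable Q) (R? : Decidable R) →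
                (∀ {f} → P f → Q f ⊎ R f) → count P? ≤ count Q? + count R?
  count-cover P? Q? R? P⇒Q⊎R = ≤-trans
    (total-mono λ f → 𝟙-cover P⇒Q⊎R (P? f) (Q? f) (R? f))
    (≤-reflexive (total-+ (λ f → 𝟙 (Q? f)) (λ f → 𝟙 (R? f))))

  count-none : ∀ {n ℓ} {P : Vec (Fin L) n → Set ℓ} (P? : Decidable P) → (∀ f → ¬ P f) → count P? ≡ 0
  count-none {n} P? none = n≤0⇒n≡0 (≤-trans
    (total-mono λ f → absent (P? f) (none f))
    (≤-reflexive (total-* {n} 0 (λ _ → 0))))
    where
    absent : ∀ {ℓ} {P : Set ℓ} (P? : Dec P) → ¬ P → 𝟙 P? ≤ 0
    absent (yes p) ¬p = contradiction p ¬p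
    absent (no _)  _  = z≤n

  -- The union bound.
  count-Any : ∀ {n ℓ₁ ℓ₂} {A : Set₁} {P : Vec (Fin L) n → Set ℓ₁} {Q : A → Vec (Fin L) n → Set ℓ₂}
              (P? : Decidable P) (Q? : ∀ a → Decidable (Q a)) (as : List A) →
              (∀ {f} → P f → Any (λ a → Q a f) as) → count P? ≤ sumˡ (map (λ a → count (Q? a)) as)
  count-Any P? Q? [] P⇒Q = ≤-reflexive (count-none P? λ f p → case P⇒Q p of λ ())
  count-Any P? Q? (a ∷ as) P⇒Q = ≤-trans
    (count-cover P? (Q? a) R? (Any.toSum ∘ P⇒Q))
    (+-monoʳ-≤ (count (Q? a)) (count-Any R? Q? as id))
    where
    R? = λ f → Any.any? (λ a → Q? a f) as

  count-witness : ∀ {n} {P : Vec (Fin L) n → Set} (P? : Decidable P) → 0 < count P? → ∃ P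
  count-witness {zero} P? 0<c with P? []
  ... | yes p = [] , p
  ... | no _  = contradiction 0<c λ ()
  count-witness {suc n} P? 0<c =
    let l , 0<cₗ = sum-positive _ 0<c
        f , p    = count-witness (λ f → P? (l ∷ f)) 0<cₗ
    in l ∷ f , p
    where
    sum-positive : ∀ {m} (s : Fin m → ℕ) → 0 < sum s → ∃ λ i → 0 < s i
    sum-positive {suc m} s 0<∑ with s zero in eq
    ... | suc _ = zero , subst (0 <_) (sym eq) (s≤s z≤n)
    ... | zero  = let i , 0<sᵢ = sum-positive (s ∘ suc) 0<∑ in suc i , 0<sᵢ

  count-positive : ∀ {n} {P : Vec (Fin L) n → Set} (P? : Decidable P) f → P f → 0 < count P?
  count-positive P? [] p with P? []
  ... | yes _ = s≤s z≤n
  ... | no ¬p = contradiction p ¬p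
  count-positive P? (l ∷ f) p =
    <-≤-trans (count-positive (λ f → P? (l ∷ f)) f p) (≤-sum (λ l → total λ f → 𝟙 (P? (l ∷ f))) l)
    where
    ≤-sum : ∀ {m} (s : Fin m → ℕ) i → s i ≤ sum s
    ≤-sum {suc m} s zero    = m≤m+n (s zero) _
    ≤-sum {suc m} s (suc i) = ≤-trans (≤-sum (s ∘ suc) i) (m≤n+m _ (s zero))

  -- P does not depend on the label of x: changing the label preserves P, and by
  -- changing it back also reflects P.
  Ignores : ∀ {n} → Fin n → (Vec (Fin L) n → Set) → Set
  Ignores x P = ∀ f l → P f → P (f [ x ]≔ l)

  ignores⁻ : ∀ {n} {x : Fin n} {P : Vec (Fin L) n → Set} → Ignores x P →
             ∀ f l → P (f [ x ]≔ l) → P f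
  ignores⁻ {x = x} {P} ign f l p = subst P
    (trans ([]≔-idempotent f x) ([]≔-lookup f x)) (ign (f [ x ]≔ l) (lookup f x) p)

  -- If P ignores the label of x, and given the other labels at most ω of the L
  -- labels of x are allowed, then at most ω / L of the labelings with P carry an
  -- allowed label at x.
  count-label : ∀ {n} (x : Fin n) {P : Vec (Fin L) n → Set} {R : Vec (Fin L) n → Fin L → Set}
                (P? : Decidable P) (R? : ∀ f → Decidable (R f)) {ω : ℕ} →
                Ignores x P → (∀ l → Ignores x (λ f → R f l)) → (∀ f → sum (λ l → 𝟙 (R? f l)) ≤ ω) →
                L * count (λ f → R? f (lookup f x) ×-dec P? f) ≤ ω * count P?
  count-label x {P} {R} P? R? {ω} P-ign R-ign R≤ω = begin
    L * count (λ f → R? f (lookup f x) ×-dec P? f)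
      ≡⟨ resample x _ ⟩
    total (λ f → sum λ l → 𝟙 (R? (f [ x ]≔ l) (lookup (f [ x ]≔ l) x) ×-dec P? (f [ x ]≔ l)))
      ≤⟨ total-mono pointwise ⟩
    total (λ f → ω * 𝟙 (P? f))
      ≡⟨ total-* ω (λ f → 𝟙 (P? f)) ⟩
    ω * count P? ∎
    where
    open ≤-Reasoning
    pointwise : ∀ f → sum (λ l → 𝟙 (R? (f [ x ]≔ l) (lookup (f [ x ]≔ l) x) ×-dec P? (f [ x ]≔ l)))
                      ≤ ω * 𝟙 (P? f)
    pointwise f with P? f
    ... | yes p = begin
      sum (λ l → 𝟙 (R? (f [ x ]≔ l) (lookup (f [ x ]≔ l) x) ×-dec P? (f [ x ]≔ l)))
        ≤⟨ sum-mono (λ l → 𝟙-mono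
             (λ (r , _) → ignores⁻ (R-ign l) f l (subst (R (f [ x ]≔ l)) (lookup∘update x f l) r)) _ (R? f l)) ⟩
      sum (λ l → 𝟙 (R? f l)) ≤⟨ R≤ω f ⟩
      ω                      ≡⟨ *-identityʳ ω ⟨
      ω * 1                  ∎
    ... | no ¬p = begin
      sum (λ l → 𝟙 (R? (f [ x ]≔ l) (lookup (f [ x ]≔ l) x) ×-dec P? (f [ x ]≔ l)))
        ≤⟨ sum-mono (λ l → none l (P? (f [ x ]≔ l))) ⟩
      sum {L} (λ _ → 0)  ≡⟨ sum-replicate-zero L ⟩
      0                  ≤⟨ z≤n ⟩
      ω * 0              ∎
      where
      none : ∀ l (q? : Dec (P (f [ x ]≔ l))) →
             𝟙 (R? (f [ x ]≔ l) (lookup (f [ x ]≔ l) x) ×-dec q?) ≤ 0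
      none l (yes q) = contradiction (ignores⁻ P-ign f l q) ¬p
      none l (no _) with R? (f [ x ]≔ l) (lookup (f [ x ]≔ l) x)
      ... | yes _ = z≤n
      ... | no _  = z≤n

-- Rosenfeld's counting argument

x∉p∖x : ∀ {n} (p : Subset n) x → x ∉ p ∖ x
x∉p∖x (inside  ∷ p) zero    ()
x∉p∖x (outside ∷ p) zero    ()
x∉p∖x (_ ∷ p)       (suc x) (there x∈p) = x∉p∖x p x x∈p

-- A way in which the label of x can complete a defect: x and m other vertices
-- all carry an allowed label.  Which labels are allowed may depend on the labels
-- of further vertices, but there are always at most ω of them.
record Flaw (L : ℕ) {n : ℕ} (m ω : ℕ) (x : Fin n) : Set₁ where
  field
    others   : List (Fin n)
    size     : length others ≡ m
    distinct : Unique (x ∷ others)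
    Allowed  : Vec (Fin L) n → Fin L → Set
    allowed? : ∀ f → Decidable (Allowed f)
    ignores  : All (λ y → ∀ l → Ignores y (λ f → Allowed f l)) (x ∷ others)
    width    : ∀ f → sum (λ l → 𝟙 (allowed? f l)) ≤ ω

  Occurs : Vec (Fin L) n → Set
  Occurs f = All (λ y → Allowed f (lookup f y)) (x ∷ others)

-- For each vertex x a list of flaws with common parameters.  The cost bounds the
-- sum over the flaws at x of ω ^ (m + 1) / β ^ m, which is the amount by which
-- these flaws can lower the growth factor L towards β.
record Kind (L n β : ℕ) : Set₁ where
  field
    {m} {ω} : ℕ
    cost  : ℕ
    flaws : (x : Fin n) → List (Flaw L m ω x)
    bound : ∀ x → length (flaws x) * ω ^ suc m ≤ cost * β ^ m

-- Rosenfeld's argument.  A labeling can be good on a set p of vertices; goodness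
-- depends on the labels in p only and is inherited by subsets.  Whenever
-- goodness is destroyed by adding x to the set, a flaw at x occurs whose other
-- vertices already belong to the set.  If the costs of the flaws leave a growth
-- factor β, then some labeling is good everywhere.
module Growth
  {L n : ℕ}
  (Good : Subset n → Vec (Fin L) n → Set) (good? : ∀ p → Decidable (Good p))
  (good-⊥ : ∀ f → Good ⊥ f)
  (good-⊆ : ∀ {p q f} → p ⊆ q → Good q f → Good p f)
  (good-local : ∀ {p x} → x ∉ p → Ignores x (Good p))
  (β : ℕ) .{{_ : NonZero β}}
  (kinds : List (Kind L n β))
  (balance : β + sumˡ (map Kind.cost kinds) ≤ L)
  (defect : ∀ {p x f} → x ∈ p → Good (p ∖ x) f → ¬ Good p f →
    Any (λ κ → Any (λ φ → All (_∈ p ∖ x) (Flaw.others φ) × Flaw.Occurs φ f) (Kind.flaws κ x)) kinds)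
  where

  -- Labels outside p are arbitrary, so that N p is L ^ (n - size of p) times the
  -- number of good labelings of p.
  N : Subset n → ℕ
  N p = count (good? p)

  -- The number of good labelings of p, those of p alone, is at least β times the
  -- number for p without x.
  Grows : Subset n → Set
  Grows p = ∀ {x} → x ∈ p → β * N (p ∖ x) ≤ L * N p

  L≢0 : NonZero L
  L≢0 = >-nonZero (<-≤-trans (>-nonZero⁻¹ β) (≤-trans (m≤m+n β _) balance))

  removed : ∀ {x} ys (p : Subset n) → x ∉ p → x ∉ foldl _∖_ p ys
  removed []       p x∉p = x∉p
  removed (y ∷ ys) p x∉p = removed ys (p ∖ y) (x∉p ∘ p─q⊆p p _)

  removed-⊆ : ∀ ys (p : Subset n) → foldl _∖_ p ys ⊆ p
  removed-⊆ []       p = id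
  removed-⊆ (y ∷ ys) p = p─q⊆p p _ ∘ removed-⊆ ys (p ∖ y)

  module _ (R : Vec (Fin L) n → Fin L → Set) (R? : ∀ f → Decidable (R f)) where

    carries? : ∀ ys → Decidable (λ f → All (λ y → R f (lookup f y)) ys)
    carries? ys f = All.all? (λ y → R? f (lookup f y)) ys

    ignores-carries : ∀ {x ys} → All (x ≢_) ys → (∀ l → Ignores x (λ f → R f l)) →
                  Ignores x (λ f → All (λ y → R f (lookup f y)) ys)
    ignores-carries []          ign f l []       = []
    ignores-carries {x} {y ∷ _} (x≢y ∷ x∉ys) ign f l (r ∷ rs) =
      subst (R (f [ x ]≔ l)) (sym (lookup∘update′ (x≢y ∘ sym) f l)) (ign (lookup f y) f l r)
      ∷ ignores-carries x∉ys ign f l rs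

    -- Labelings that are good off ys and allowed on ys.  For each vertex of ys the
    -- requirement costs a factor ω / L, and restoring the vertex to the domain of
    -- goodness costs a factor L / β by growth.
    forget : ∀ {ω} → (∀ f → sum (λ l → 𝟙 (R? f l)) ≤ ω) →
             ∀ ys p → (∀ q → ∣ q ∣ ≤ ∣ p ∣ → Grows q) → Unique ys → All (_∈ p) ys →
             All (λ y → ∀ l → Ignores y (λ f → R f l)) ys →
             β ^ length ys * count (λ f → carries? ys f ×-dec good? (foldl _∖_ p ys) f) ≤ ω ^ length ys * N p
    forget width [] p grows _ _ _ = *-monoʳ-≤ 1 (count-mono _ (good? p) proj₂)
    forget {ω} width (y ∷ ys) p grows (y∉ys ∷ uniq) (y∈p ∷ ys⊆p) (ign ∷ igns) = *-cancelˡ-≤ L {{L≢0}} (begin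
      L * (β * β ^ j * count (λ f → carries? (y ∷ ys) f ×-dec good? q f))
        ≤⟨ *-monoʳ-≤ L (*-monoʳ-≤ (β * β ^ j) (count-mono _
             (λ f → R? f (lookup f y) ×-dec (carries? ys f ×-dec good? q f))
             λ where (r ∷ rs , g) → r , rs , g)) ⟩
      L * (β * β ^ j * count (λ f → R? f (lookup f y) ×-dec (carries? ys f ×-dec good? q f)))
        ≡⟨ swap L (β * β ^ j) _ ⟩
      β * β ^ j * (L * count (λ f → R? f (lookup f y) ×-dec (carries? ys f ×-dec good? q f)))
        ≤⟨ *-monoʳ-≤ (β * β ^ j) (count-label y (λ f → carries? ys f ×-dec good? q f) R?
             (λ f l (rs , g) → ignores-carries y∉ys ign f l rs , good-local (removed ys (p ∖ y) (x∉p∖x p y)) f l g)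
             ign width) ⟩
      β * β ^ j * (ω * M)
        ≡⟨ reorder β (β ^ j) ω M ⟩
      ω * (β * (β ^ j * M))
        ≤⟨ *-monoʳ-≤ ω (*-monoʳ-≤ β (forget width ys (p ∖ y) grows′ uniq ys⊆p∖y igns)) ⟩
      ω * (β * (ω ^ j * N (p ∖ y)))
        ≡⟨ cong (ω *_) (swap β (ω ^ j) (N (p ∖ y))) ⟩
      ω * (ω ^ j * (β * N (p ∖ y)))
        ≤⟨ *-monoʳ-≤ ω (*-monoʳ-≤ (ω ^ j) (grows p ≤-refl y∈p)) ⟩
      ω * (ω ^ j * (L * N p))
        ≡⟨ reorder′ ω (ω ^ j) L (N p) ⟩
      L * (ω * ω ^ j * N p) ∎)
      where
      open ≤-Reasoning
      j = length ys
      q = foldl _∖_ (p ∖ y) ys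
      M = count (λ f → carries? ys f ×-dec good? q f)
      swap : ∀ a b c → a * (b * c) ≡ b * (a * c)
      swap = solve-∀
      reorder : ∀ a b c d → a * b * (c * d) ≡ c * (a * (b * d))
      reorder = solve-∀
      reorder′ : ∀ a b c d → a * (b * (c * d)) ≡ c * (a * b * d)
      reorder′ = solve-∀
      grows′ : ∀ r → ∣ r ∣ ≤ ∣ p ∖ y ∣ → Grows r
      grows′ r r≤ = grows r (≤-trans r≤ (<⇒≤ (x∈p⇒∣p-x∣<∣p∣ y∈p)))
      ys⊆p∖y : All (_∈ p ∖ y) ys
      ys⊆p∖y = All.zipWith (λ (z∈p , y≢z) → x∈p∧x≢y⇒x∈p-y z∈p (y≢z ∘ sym)) (ys⊆p , y∉ys)

  -- A flaw inside p occurs although the labeling is good on p.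
  Arises : ∀ {m ω x} → Subset n → Flaw L m ω x → Vec (Fin L) n → Set
  Arises p φ f = (All (_∈ p) (Flaw.others φ) × Flaw.Occurs φ f) × Good p f

  arises? : ∀ {m ω x} p (φ : Flaw L m ω x) → Decidable (Arises p φ)
  arises? p φ f = (All.all? (_∈? p) (Flaw.others φ) ×-dec
                   All.all? (λ y → Flaw.allowed? φ f (lookup f y)) _) ×-dec good? p f

  -- A flaw arises in at most ω ^ (m + 1) / (L β ^ m) of the good labelings.
  count-flaw : ∀ {m ω x} (φ : Flaw L m ω x) p → (∀ q → ∣ q ∣ ≤ ∣ p ∣ → Grows q) → x ∉ p →
               L * (β ^ m * count (arises? p φ)) ≤ ω ^ suc m * N p
  count-flaw {m} {ω} {x} φ p grows x∉p = by-case (All.all? (_∈? p) (Flaw.others φ))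
    where
    open ≤-Reasoning
    swap : ∀ a b c → a * (b * c) ≡ b * (a * c)
    swap = solve-∀
    by-case : Dec (All (_∈ p) (Flaw.others φ)) → L * (β ^ m * count (arises? p φ)) ≤ ω ^ suc m * N p
    by-case (no ⊈p) = begin
      L * (β ^ m * count (arises? p φ))
        ≡⟨ cong (λ c → L * (β ^ m * c)) (count-none (arises? p φ) λ _ ((⊆p , _) , _) → contradiction ⊆p ⊈p) ⟩
      L * (β ^ m * 0)
        ≡⟨ cong (L *_) (*-zeroʳ (β ^ m)) ⟩
      L * 0
        ≡⟨ *-zeroʳ L ⟩
      0
        ≤⟨ z≤n ⟩
      ω ^ suc m * N p ∎
    by-case (yes ⊆p) with Flaw.distinct φ | Flaw.ignores φ
    ... | x∉ys ∷ uniq | ign ∷ igns = begin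
      L * (β ^ m * count (arises? p φ))
        ≡⟨ swap L (β ^ m) _ ⟩
      β ^ m * (L * count (arises? p φ))
        ≤⟨ *-monoʳ-≤ (β ^ m) (*-monoʳ-≤ L (count-mono (arises? p φ)
             (λ f → allowed? f (lookup f x) ×-dec (carried f ×-dec good? q f))
             λ where ((_ , (r ∷ rs)) , g) → r , rs , good-⊆ (removed-⊆ ys p) g)) ⟩
      β ^ m * (L * count (λ f → allowed? f (lookup f x) ×-dec (carried f ×-dec good? q f)))
        ≤⟨ *-monoʳ-≤ (β ^ m) (count-label x (λ f → carried f ×-dec good? q f) allowed?
             (λ f l (rs , g) → ignores-carries Allowed allowed? x∉ys ign f l rs ,
                good-local (removed ys p x∉p) f l g)
             ign width) ⟩
      β ^ m * (ω * count (λ f → carried f ×-dec good? q f))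
        ≡⟨ swap (β ^ m) ω _ ⟩
      ω * (β ^ m * count (λ f → carried f ×-dec good? q f))
        ≤⟨ *-monoʳ-≤ ω (subst (λ j → β ^ j * count (λ f → carried f ×-dec good? q f) ≤ ω ^ j * N p) size
             (forget Allowed allowed? width ys p grows uniq ⊆p igns)) ⟩
      ω * (ω ^ m * N p)
        ≡⟨ *-assoc ω (ω ^ m) (N p) ⟨
      ω ^ suc m * N p ∎
      where
      open Flaw φ using (size; Allowed; allowed?; width) renaming (others to ys)
      q = foldl _∖_ p ys
      carried = carries? Allowed allowed? ys

  sumˡ-bound : ∀ {A : Set₁} (c : ℕ) (s : A → ℕ) {b} → (∀ a → c * s a ≤ b) →
               ∀ as → c * sumˡ (map s as) ≤ length as * b
  sumˡ-bound c s s≤b []       = ≤-reflexive (*-zeroʳ c)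
  sumˡ-bound c s {b} s≤b (a ∷ as) = begin
    c * (s a + sumˡ (map s as))      ≡⟨ *-distribˡ-+ c (s a) _ ⟩
    c * s a + c * sumˡ (map s as)    ≤⟨ +-mono-≤ (s≤b a) (sumˡ-bound c s s≤b as) ⟩
    b + length as * b                ∎
    where open ≤-Reasoning

  module _ (p : Subset n) (grows : ∀ q → ∣ q ∣ ≤ ∣ p ∣ → Grows q) {x : Fin n} (x∉p : x ∉ p) where

    -- The flaws at x of one kind, counted with the labelings in which they arise.
    kind-count : Kind L n β → ℕ
    kind-count κ = sumˡ (map (λ φ → count (arises? p φ)) (Kind.flaws κ x))

    count-kind : ∀ κ → L * kind-count κ ≤ Kind.cost κ * N p
    count-kind κ = *-cancelˡ-≤ (β ^ m) {{m^n≢0 β m}} (begin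
      β ^ m * (L * kind-count κ)
        ≡⟨ reassoc (β ^ m) L _ ⟩
      L * β ^ m * kind-count κ
        ≤⟨ sumˡ-bound (L * β ^ m) (λ φ → count (arises? p φ))
             (λ φ → ≤-trans (≤-reflexive (*-assoc L (β ^ m) _)) (count-flaw φ p grows x∉p)) (flaws x) ⟩
      length (flaws x) * (ω ^ suc m * N p)
        ≡⟨ *-assoc (length (flaws x)) (ω ^ suc m) (N p) ⟨
      length (flaws x) * ω ^ suc m * N p
        ≤⟨ *-monoˡ-≤ (N p) (bound x) ⟩
      cost * β ^ m * N p
        ≡⟨ reorder cost (β ^ m) (N p) ⟩
      β ^ m * (cost * N p) ∎)
      where
      open ≤-Reasoning
      open Kind κ
      reassoc : ∀ a b c → a * (b * c) ≡ b * a * c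
      reassoc = solve-∀
      reorder : ∀ a b c → a * b * c ≡ b * (a * c)
      reorder = solve-∀

    count-kinds : ∀ κs → L * sumˡ (map kind-count κs) ≤ sumˡ (map Kind.cost κs) * N p
    count-kinds []       = ≤-reflexive (*-zeroʳ L)
    count-kinds (κ ∷ κs) = begin
      L * (kind-count κ + sumˡ (map kind-count κs))
        ≡⟨ *-distribˡ-+ L (kind-count κ) _ ⟩
      L * kind-count κ + L * sumˡ (map kind-count κs)
        ≤⟨ +-mono-≤ (count-kind κ) (count-kinds κs) ⟩
      Kind.cost κ * N p + sumˡ (map Kind.cost κs) * N p
        ≡⟨ *-distribʳ-+ (N p) (Kind.cost κ) _ ⟨
      (Kind.cost κ + sumˡ (map Kind.cost κs)) * N p ∎
      where open ≤-Reasoning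

  -- The induction step: a labeling that is good on p without x is good on p
  -- unless a flaw at x arises.
  grow : ∀ p → (∀ q → ∣ q ∣ < ∣ p ∣ → Grows q) → Grows p
  grow p grows {x} x∈p = +-cancelʳ-≤ (costs * N q) _ _ (begin
    β * N q + costs * N q
      ≡⟨ *-distribʳ-+ (N q) β costs ⟨
    (β + costs) * N q
      ≤⟨ *-monoˡ-≤ (N q) balance ⟩
    L * N q
      ≤⟨ *-monoʳ-≤ L (count-cover (good? q) (good? p) (λ f → kinds? f ×-dec good? q f) covered) ⟩
    L * (N p + count (λ f → kinds? f ×-dec good? q f))
      ≡⟨ *-distribˡ-+ L (N p) _ ⟩
    L * N p + L * count (λ f → kinds? f ×-dec good? q f)
      ≤⟨ +-monoʳ-≤ (L * N p) (*-monoʳ-≤ L flawed) ⟩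
    L * N p + L * sumˡ (map (kind-count q grows′ x∉q) kinds)
      ≤⟨ +-monoʳ-≤ (L * N p) (count-kinds q grows′ x∉q kinds) ⟩
    L * N p + costs * N q ∎)
    where
    open ≤-Reasoning
    q = p ∖ x
    costs = sumˡ (map Kind.cost kinds)
    x∉q : x ∉ q
    x∉q = x∉p∖x p x
    grows′ : ∀ r → ∣ r ∣ ≤ ∣ q ∣ → Grows r
    grows′ r r≤ = grows r (≤-<-trans r≤ (x∈p⇒∣p-x∣<∣p∣ x∈p))
    kind? : ∀ κ → Decidable λ f → Any (λ φ → Arises q φ f) (Kind.flaws κ x)
    kind? κ f = Any.any? (λ φ → arises? q φ f) _
    kinds? : Decidable λ f → Any (λ κ → Any (λ φ → Arises q φ f) (Kind.flaws κ x)) kinds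
    kinds? f = Any.any? (λ κ → kind? κ f) kinds
    covered : ∀ {f} → Good q f → _
    covered {f} g with good? p f
    ... | yes g′ = inj₁ g′
    ... | no ¬g′ = inj₂ (Any.map (Any.map (_, g)) (defect x∈p g ¬g′) , g)
    flawed : count (λ f → kinds? f ×-dec good? q f) ≤ sumˡ (map (kind-count q grows′ x∉q) kinds)
    flawed = ≤-trans
      (count-Any (λ f → kinds? f ×-dec good? q f) kind? kinds proj₁)
      (sum-map-mono (λ κ → count-Any (kind? κ) (arises? q) (Kind.flaws κ x) id) kinds)
      where
      sum-map-mono : ∀ {A : Set₁} {s t : A → ℕ} → (∀ a → s a ≤ t a) → ∀ as → sumˡ (map s as) ≤ sumˡ (map t as)
      sum-map-mono s≤t []       = z≤n
      sum-map-mono s≤t (a ∷ as) = +-mono-≤ (s≤t a) (sum-map-mono s≤t as)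

  all-grow : ∀ p → Grows p
  all-grow p = go p (<-wellFounded ∣ p ∣)
    where
    go : ∀ p → Acc _<_ ∣ p ∣ → Grows p
    go p (acc rec) = grow p λ q q<p → go q (rec q<p)

  positive : ∀ p → 0 < N p
  positive p = go p (<-wellFounded ∣ p ∣)
    where
    label : ∀ {l} → .{{NonZero l}} → Fin l
    label {suc _} = zero
    go : ∀ p → Acc _<_ ∣ p ∣ → 0 < N p
    go p (acc rec) with nonempty? p
    ... | no empty = count-positive (good? p) f (subst (λ q → Good q f) (sym (Empty-unique empty)) (good-⊥ f))
      where f = replicate n (label {{L≢0}})
    ... | yes (x , x∈p) = *-cancelˡ-< L 0 (N p) (begin-strict
      L * 0          ≡⟨ *-zeroʳ L ⟩
      0              <⟨ *-mono-< (>-nonZero⁻¹ β) (go (p ∖ x) (rec (x∈p⇒∣p-x∣<∣p∣ x∈p))) ⟩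
      β * N (p ∖ x)  ≤⟨ all-grow p x∈p ⟩
      L * N p        ∎)
      where open ≤-Reasoning

  good-exists : ∃ (Good ⊤)
  good-exists = count-witness (good? ⊤) (positive ⊤)

-- Sublists and missed elements

Unique-⊆ : ∀ {A : Set} {xs ys : List A} → xs ⊆ˡ ys → Unique ys → Unique xs
Unique-⊆ []          []         = []
Unique-⊆ (_ ∷ʳ p)    (_ ∷ u)    = Unique-⊆ p u
Unique-⊆ (refl ∷ p)  (x∉ ∷ u)   = All-resp-⊆ p x∉ ∷ Unique-⊆ p u

module _ {n : ℕ} where

  -- The list without the occurrences of x.
  except : Fin n → List (Fin n) → List (Fin n)
  except x = filter (λ y → ¬? (x ≟ᶠ y))

  except-∉ : ∀ x xs → All (x ≢_) (except x xs)
  except-∉ x xs = All.all-filter (λ y → ¬? (x ≟ᶠ y)) xs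

  except-∈ : ∀ {x y} xs → y ∈ˡ except x xs → y ∈ˡ xs
  except-∈ {x} xs = proj₁ ∘ ∈-filter⁻ (λ y → ¬? (x ≟ᶠ y)) {xs = xs}

  except-unique : ∀ x {xs} → Unique xs → Unique (except x xs)
  except-unique x = filter⁺ (λ y → ¬? (x ≟ᶠ y))

  length-except : ∀ {x xs} → Unique xs → x ∈ˡ xs → suc (length (except x xs)) ≡ length xs
  length-except {x} {y ∷ ys} (y∉ys ∷ u) x∈ with x ≟ᶠ y
  ... | yes refl = cong (suc ∘ length) (filter-all (λ z → ¬? (x ≟ᶠ z)) y∉ys)
  length-except (y∉ys ∷ u) (here x≡y)  | no x≢y = contradiction x≡y x≢y
  length-except (y∉ys ∷ u) (there x∈)  | no x≢y = cong suc (length-except u x∈)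

-- The sublists with s elements; positions count, not values.
choose : ∀ {A : Set} → ℕ → List A → List (List A)
choose zero    xs       = [] ∷ []
choose (suc s) []       = []
choose (suc s) (x ∷ xs) = map (x ∷_) (choose s xs) ++ choose (suc s) xs

choose-⊆ : ∀ {A : Set} s (xs : List A) → All (λ ys → ys ⊆ˡ xs × length ys ≡ s) (choose s xs)
choose-⊆ zero    xs       = ([]⊆ xs , refl) ∷ []
choose-⊆ (suc s) []       = []
choose-⊆ (suc s) (x ∷ xs) = All.++⁺
  (All.map⁺ (All.map (λ (⊆xs , len) → refl ∷ ⊆xs , cong suc len) (choose-⊆ s xs)))
  (All.map (λ (⊆xs , len) → x ∷ʳ ⊆xs , len) (choose-⊆ (suc s) xs))

choose-satisfying : ∀ {A : Set} {P : A → Set} (P? : Decidable P) s xs → s ≤ length (filter P? xs) →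
                    Any (All P) (choose s xs)
choose-satisfying P? zero    xs       _ = here []
choose-satisfying P? (suc s) (x ∷ xs) s≤ with P? x
... | yes p = Any.++⁺ˡ (Any.map⁺ (Any.map (p ∷_) (choose-satisfying P? s xs (s≤s⁻¹ s≤))))
... | no _  = Any.++⁺ʳ _ (choose-satisfying P? (suc s) xs s≤)

suc-P′-suc : ∀ n s → suc n P′ suc s ≡ suc n * (n P′ s)
suc-P′-suc n zero    = refl
suc-P′-suc n (suc s) = begin
  (n ∸ s) * (suc n P′ suc s)     ≡⟨ cong ((n ∸ s) *_) (suc-P′-suc n s) ⟩
  (n ∸ s) * (suc n * (n P′ s))   ≡⟨ swap (n ∸ s) (suc n) (n P′ s) ⟩
  suc n * ((n ∸ s) * (n P′ s))   ∎
  where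
  open ≡-Reasoning
  swap : ∀ a b c → a * (b * c) ≡ b * (a * c)
  swap = solve-∀

P′-zero : ∀ {n s} → n < s → n P′ s ≡ 0
P′-zero {n} {suc s} (s≤s n≤s) = cong (_* (n P′ s)) (m≤n⇒m∸n≡0 n≤s)

-- n P′ s is the falling factorial n (n - 1) ... (n - s + 1).
length-choose : ∀ {A : Set} s (xs : List A) → length (choose s xs) * s ! ≤ length xs P′ s
length-choose zero    xs       = ≤-refl
length-choose (suc s) []       = z≤n
length-choose (suc s) (x ∷ xs) = begin
  length (map (x ∷_) (choose s xs) ++ choose (suc s) xs) * suc s !
    ≡⟨ cong (_* suc s !) (trans (length-++ (map (x ∷_) (choose s xs)))
         (cong (_+ length (choose (suc s) xs)) (length-map (x ∷_) (choose s xs)))) ⟩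
  (length (choose s xs) + length (choose (suc s) xs)) * suc s !
    ≡⟨ expand (length (choose s xs)) (length (choose (suc s) xs)) (suc s) (s !) ⟩
  suc s * (length (choose s xs) * s !) + length (choose (suc s) xs) * suc s !
    ≤⟨ +-mono-≤ (*-monoʳ-≤ (suc s) (length-choose s xs)) (length-choose (suc s) xs) ⟩
  suc s * (m P′ s) + (m ∸ s) * (m P′ s)
    ≡⟨ pascal ⟩
  suc m * (m P′ s)
    ≡⟨ suc-P′-suc m s ⟨
  suc m P′ suc s ∎
  where
  open ≤-Reasoning
  m = length xs
  expand : ∀ a b c d → (a + b) * (c * d) ≡ c * (a * d) + b * (c * d)
  expand = solve-∀
  pascal : suc s * (m P′ s) + (m ∸ s) * (m P′ s) ≡ suc m * (m P′ s)
  pascal with s ≤? m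
  ... | yes s≤m = trans (sym (*-distribʳ-+ (m P′ s) (suc s) (m ∸ s)))
                        (cong (λ j → suc j * (m P′ s)) (m+[n∸m]≡n s≤m))
  ... | no s≰m rewrite P′-zero (≰⇒> s≰m) =
    trans (cong₂ _+_ (*-zeroʳ (suc s)) (*-zeroʳ (m ∸ s))) (sym (*-zeroʳ (suc m)))

-- A list shorter than s misses an element of Fin s.
missing : ∀ {s} (xs : List (Fin s)) → length xs < s → ∃ λ j → ¬ j ∈ˡ xs
missing {s} xs short with any? (λ j → ¬? (dec-∈ _≟ᶠ_ j xs))
... | yes found = found
... | no none   =
  let i , j , i<j , same = pigeonhole short (index ∘ present) in
  contradiction (trans (Any.lookup-index (present i))
                  (trans (cong (lookupˡ xs) same) (sym (Any.lookup-index (present j)))))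
    (<⇒≢ i<j)
  where
  present : ∀ j → j ∈ˡ xs
  present j = decidable-stable (dec-∈ _≟ᶠ_ j xs) λ j∉ → none (j , j∉)

-- Sets of labels

one-label : ∀ {L} (k : Fin L) → sum (λ l → 𝟙 (l ≟ᶠ k)) ≤ 1
one-label {suc L} zero    = s≤s (≤-trans
  (sum-mono {L} {t = λ _ → 0} λ l → z≤n) (≤-reflexive (sum-replicate-zero L)))
one-label {suc L} (suc k) = ≤-trans
  (sum-mono {L} λ l → 𝟙-mono suc-injective (suc l ≟ᶠ suc k) (l ≟ᶠ k)) (one-label k)

-- The first a labels stand for in, the remaining ones for out: with a + b labels
-- in all, the two cases have weights a and b.
In : ∀ {L} → ℕ → Fin L → Set
In a l = toℕ l < a

in-labels : ∀ a b → sum {a + b} (λ l → 𝟙 (toℕ l <? a)) ≤ a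
in-labels zero    b = ≤-trans
  (sum-mono {b} {t = λ _ → 0} λ l → 𝟙-no (toℕ l <? 0)) (≤-reflexive (sum-replicate-zero b))
  where
  𝟙-no : ∀ {i} (d : Dec (i < 0)) → 𝟙 d ≤ 0
  𝟙-no (no _) = z≤n
in-labels (suc a) b = s≤s (≤-trans
  (sum-mono {a + b} λ l → 𝟙-mono s≤s⁻¹ (suc (toℕ l) <? suc a) (toℕ l <? a)) (in-labels a b))

out-labels : ∀ a b → sum {a + b} (λ l → 𝟙 (¬? (toℕ l <? a))) ≤ b
out-labels zero    b = ≤-trans
  (sum-mono {b} {t = λ _ → 1} λ l → 𝟙≤1 (¬? (toℕ l <? 0)))
  (≤-reflexive (trans (sum-const b 1) (*-identityʳ b)))
  where
  𝟙≤1 : ∀ {P : Set} (d : Dec P) → 𝟙 d ≤ 1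
  𝟙≤1 (yes _) = ≤-refl
  𝟙≤1 (no _)  = z≤n
out-labels (suc a) b = ≤-trans
  (sum-mono {a + b} λ l → 𝟙-mono (λ l≮a l<a → l≮a (s≤s l<a)) (¬? (suc (toℕ l) <? suc a)) (¬? (toℕ l <? a)))
  (out-labels a b)

-- Neighborhoods

module _ {n : ℕ} (G : Graph n) where
  open Graph G

  ∈-neighbors : ∀ {v u} → v ~ u → u ∈ˡ neighbors v
  ∈-neighbors {v} {u} v~u = ∈-filter⁺ (v ~?_) (∈-allFin u) v~u

  neighbors-~ : ∀ {v u} → u ∈ˡ neighbors v → v ~ u
  neighbors-~ {v} = proj₂ ∘ ∈-filter⁻ (v ~?_) {xs = allFin n}

  neighbors-unique : ∀ v → Unique (neighbors v)
  neighbors-unique v = filter⁺ (v ~?_) (allFin⁺ n)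

  ~⇒≢ : ∀ {u v} → u ~ v → u ≢ v
  ~⇒≢ u~v u≡v = irrefl u≡v u~v

  near : ∀ {x v u} → v ~ x → u ∈ˡ x ∷ except x (neighbors v) → v ~ u
  near v~x (here refl) = v~x
  near {v = v} v~x (there u∈) = neighbors-~ (except-∈ (neighbors v) u∈)

  -- The neighborhood of v lies in p.
  Complete : Subset n → Fin n → Set
  Complete p v = ∀ u → v ~ u → u ∈ p

  complete? : ∀ p → Decidable (Complete p)
  complete? p v = all? λ u → (v ~? u) →-dec (u ∈? p)

  complete-⊤ : ∀ v → Complete ⊤ v
  complete-⊤ v u _ = ∈⊤

  complete-⊆ : ∀ {p q v} → p ⊆ q → Complete p v → Complete q v
  complete-⊆ p⊆q comp u v~u = p⊆q (comp u v~u)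

  complete-- : ∀ {p x v} → ¬ v ~ x → Complete p v → Complete (p ∖ x) v
  complete-- v≁x comp u v~u = x∈p∧x≢y⇒x∈p-y (comp u v~u) λ where refl → v≁x v~u

  module _ {k : ℕ} (reg : Regular G k) where

    neighbor : .{{NonZero k}} → ∀ v → ∃ (v ~_)
    neighbor v with neighbors v in eq | reg v
    ... | u ∷ _ | _ = u , neighbors-~ (subst (u ∈ˡ_) (sym eq) (here refl))
    neighbor {{}} v | [] | refl

    length-others : ∀ {x v} → v ~ x → suc (length (except x (neighbors v))) ≡ k
    length-others {x} {v} v~x = trans (length-except (neighbors-unique v) (∈-neighbors v~x)) (reg v)

    length-flaws : ∀ {A : Set₁} x (h : ∀ {y} → y ∈ˡ neighbors x → A) → length (mapWith∈ (neighbors x) h) ≡ k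
    length-flaws x h = trans (length-mapWith∈ (setoid (Fin n)) (neighbors x)) (reg x)

    others-⊆ : ∀ {p x v} → Complete p v → All (_∈ p ∖ x) (except x (neighbors v))
    others-⊆ {p} {x} {v} comp = All.tabulate λ {y} y∈ → x∈p∧x≢y⇒x∈p-y
      (comp y (neighbors-~ (except-∈ (neighbors v) y∈)))
      (≢-sym (All.lookup (except-∉ x (neighbors v)) y∈))

-- Dynamic colorings with few colors beyond the degree

-- A dynamic coloring with k + 2 + e colors is a labeling by colors.  The growth
-- rate is 2: the k neighbors of a vertex x forbid at most k colors for x, and the
-- k neighborhoods containing x, which must not become monochromatic, cost e.
module FewColors
  {n k′ : ℕ} (G : Graph n) (reg : Regular G (2 + k′)) (e : ℕ) (small : 2 + k′ ≤ e * 2 ^ k′) where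
  open Graph G

  k L : ℕ
  k = 2 + k′
  -- This is literally the growth rate plus the sum of the costs below.
  L = 2 + (k + (e + 0))

  -- The coloring is proper on p, and no neighborhood inside p is monochromatic.
  Good : Subset n → Vec (Fin L) n → Set
  Good p f = (∀ u v → u ∈ p → v ∈ p → u ~ v → lookup f u ≢ lookup f v) ×
             (∀ v → Complete G p v → ∃₂ λ u w → v ~ u × v ~ w × lookup f u ≢ lookup f w)

  two? : ∀ (f : Vec (Fin L) n) v → Dec (∃₂ λ u w → v ~ u × v ~ w × lookup f u ≢ lookup f w)
  two? f v = any? λ u → any? λ w → (v ~? u) ×-dec (v ~? w) ×-dec ¬? (lookup f u ≟ᶠ lookup f w)

  good? : ∀ p → Decidable (Good p)
  good? p f =
    (all? λ u → all? λ v → (u ∈? p) →-dec ((v ∈? p) →-dec ((u ~? v) →-dec ¬? (lookup f u ≟ᶠ lookup f v))))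
    ×-dec (all? λ v → complete? G p v →-dec two? f v)

  good-⊥ : ∀ f → Good ⊥ f
  good-⊥ f = (λ u v u∈ → contradiction u∈ ∉⊥) ,
             λ v comp → let u , v~u = neighbor G reg v in contradiction (comp u v~u) ∉⊥

  good-⊆ : ∀ {p q f} → p ⊆ q → Good q f → Good p f
  good-⊆ p⊆q (proper , two) = (λ u v u∈ v∈ → proper u v (p⊆q u∈) (p⊆q v∈)) ,
                              λ v comp → two v (complete-⊆ G {v = v} p⊆q comp)

  good-local : ∀ {p x} → x ∉ p → Ignores x (Good p)
  good-local {p} {x} x∉p f l (proper , two) =
    (λ u v u∈ v∈ u~v → subst₂ _≢_ (sym (same u∈)) (sym (same v∈)) (proper u v u∈ v∈ u~v)) ,
    λ v comp → let u , w , v~u , v~w , ne = two v comp in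
      u , w , v~u , v~w , subst₂ _≢_ (sym (same (comp u v~u))) (sym (same (comp w v~w))) ne
    where
    same : ∀ {u} → u ∈ p → lookup (f [ x ]≔ l) u ≡ lookup f u
    same u∈ = lookup∘update′ (λ where refl → x∉p u∈) f l

  -- The color of x equals the color of a fixed neighbor.
  conflict : ∀ {x y} → x ~ y → Flaw L 0 1 x
  conflict {x} {y} x~y = record
    { others   = []
    ; size     = refl
    ; distinct = [] ∷ []
    ; Allowed  = λ f l → l ≡ lookup f y
    ; allowed? = λ f l → l ≟ᶠ lookup f y
    ; ignores  = (λ l f l′ eq → trans eq (sym (lookup∘update′ (≢-sym (~⇒≢ G x~y)) f l′))) ∷ []
    ; width    = λ f → one-label (lookup f y)
    }

  -- The vertices of x ∷ ys agree in color.  The first vertex y of the list serves as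
  -- reference: it is not among the vertices of the flaw, and the color of every
  -- other one must equal that of y.
  agree : ∀ {x : Fin n} (ys : List (Fin n)) → All (x ≢_) ys → Unique ys → suc (length ys) ≡ k → Flaw L k′ 1 x
  agree (y ∷ ys) (x≢y ∷ x∉ys) (y∉ys ∷ uniq) len = record
    { others   = ys
    ; size     = cong (pred ∘ pred) len
    ; distinct = x∉ys ∷ uniq
    ; Allowed  = λ f l → l ≡ lookup f y
    ; allowed? = λ f l → l ≟ᶠ lookup f y
    ; ignores  = All.map (λ z≢y l f l′ eq → trans eq (sym (lookup∘update′ (≢-sym z≢y) f l′)))
                   (x≢y ∷ All.map ≢-sym y∉ys)
    ; width    = λ f → one-label (lookup f y)
    }

  agree-occurs : ∀ {x} f {q : Subset n} ys x∉ uniq len → All (_∈ q) ys →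
                 (∀ u w → u ∈ˡ x ∷ ys → w ∈ˡ x ∷ ys → lookup f u ≡ lookup f w) →
                 All (_∈ q) (Flaw.others (agree {x} ys x∉ uniq len)) × Flaw.Occurs (agree {x} ys x∉ uniq len) f
  agree-occurs f (y ∷ ys) (_ ∷ _) (_ ∷ _) len (_ ∷ ys⊆q) same = ys⊆q ,
    same _ y (here refl) (there (here refl)) ∷
    All.tabulate λ z∈ → same _ y (there (there z∈)) (there (here refl))

  -- The neighborhood of v, which contains x, is monochromatic.  One vertex being the
  -- reference, k - 2 vertices besides x have a prescribed color.
  mono : ∀ {x v} → v ~ x → Flaw L k′ 1 x
  mono {x} {v} v~x = agree (except x (neighbors v)) (except-∉ x (neighbors v))
    (except-unique x (neighbors-unique G v)) (length-others G reg v~x)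

  mono-occurs : ∀ {p x v f} (v~x : v ~ x) → Complete G p v →
                ¬ (∃₂ λ u w → v ~ u × v ~ w × lookup f u ≢ lookup f w) →
                All (_∈ p ∖ x) (Flaw.others (mono v~x)) × Flaw.Occurs (mono v~x) f
  mono-occurs {p} {x} {v} {f} v~x comp ¬two = agree-occurs f (except x (neighbors v))
    (except-∉ x (neighbors v)) (except-unique x (neighbors-unique G v)) (length-others G reg v~x)
    (others-⊆ G reg {v = v} comp)
    λ u w u∈ w∈ → decidable-stable (lookup f u ≟ᶠ lookup f w)
      λ ne → ¬two (u , w , near G v~x u∈ , near G v~x w∈ , ne)

  kinds : List (Kind L n 2)
  kinds = record
            { cost  = k
            ; flaws = λ x → mapWith∈ (neighbors x) (λ y∈ → conflict (neighbors-~ G y∈))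
            ; bound = λ x → ≤-reflexive (cong (_* 1) (length-flaws G reg x (λ y∈ → conflict (neighbors-~ G y∈))))
            }
        ∷ record
            { cost  = e
            ; flaws = λ x → mapWith∈ (neighbors x) (λ v∈ → mono (sym-~ (neighbors-~ G v∈)))
            ; bound = λ x → begin
                length (mapWith∈ (neighbors x) (λ v∈ → mono (sym-~ (neighbors-~ G v∈)))) * 1 ^ suc k′
                  ≡⟨ cong₂ _*_ (length-flaws G reg x (λ v∈ → mono (sym-~ (neighbors-~ G v∈)))) (^-zeroˡ (suc k′)) ⟩
                k * 1      ≡⟨ *-identityʳ k ⟩
                k          ≤⟨ small ⟩
                e * 2 ^ k′ ∎
            }
        ∷ []
    where open ≤-Reasoning

  -- Without a color conflict at x and without a monochromatic neighborhood through
  -- x, goodness extends to x.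
  defect : ∀ {p x f} → x ∈ p → Good (p ∖ x) f → ¬ Good p f →
    Any (λ κ → Any (λ φ → All (_∈ p ∖ x) (Flaw.others φ) × Flaw.Occurs φ f) (Kind.flaws κ x)) kinds
  defect {p} {x} {f} x∈p (proper , two) ¬good with
      any? (λ y → (x ~? y) ×-dec (lookup f x ≟ᶠ lookup f y))
    | any? (λ v → (v ~? x) ×-dec complete? G p v ×-dec ¬? (two? f v))
  ... | yes (y , x~y , same) | _ =
    here (Any.mapWith∈⁺ _ (y , ∈-neighbors G x~y , [] , same ∷ []))
  ... | no _ | yes (v , v~x , comp , ¬two) =
    there (here (Any.mapWith∈⁺ _ (v , ∈-neighbors G (sym-~ v~x) ,
      mono-occurs {f = f} (sym-~ (neighbors-~ G (∈-neighbors G (sym-~ v~x)))) comp ¬two)))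
  ... | no ok | no ok′ = contradiction (proper′ , two′) ¬good
    where
    proper′ : ∀ u v → u ∈ p → v ∈ p → u ~ v → lookup f u ≢ lookup f v
    proper′ u v u∈ v∈ u~v same with u ≟ᶠ x | v ≟ᶠ x
    ... | yes refl | _        = ok (v , u~v , same)
    ... | no _     | yes refl = ok (u , sym-~ u~v , sym same)
    ... | no u≢x   | no v≢x   = proper u v (x∈p∧x≢y⇒x∈p-y u∈ u≢x) (x∈p∧x≢y⇒x∈p-y v∈ v≢x) u~v same
    two′ : ∀ v → Complete G p v → _
    two′ v comp with v ~? x
    ... | no v≁x  = two v (complete-- G {v = v} v≁x comp)
    ... | yes v~x = decidable-stable (two? f v) λ ¬two → ok′ (v , v~x , comp , ¬two)

  dynamicColorable : DynamicColorable G L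
  dynamicColorable =
    let f , proper , two =
          Growth.good-exists Good good? good-⊥ (λ {p} {q} {f} → good-⊆ {p} {q} {f}) good-local 2 kinds ≤-refl defect
    in
    lookup f , (λ u v → proper u v ∈⊤ ∈⊤) , λ v _ → two v (complete-⊤ G v)

-- Recoloring a set of vertices with new colors

-- The set T of the vertices that are in, found by labeling them with a labels for
-- in and b labels for out; see the introduction.  The three bounds are on the
-- neighborhoods that are all out, on those that are all in, and on the stars that
-- are all in.
module InOut
  {n k′ : ℕ} (G : Graph n) (reg : Regular G (suc k′))
  (a b β s eₒ eᵢ eₛ : ℕ) .{{_ : NonZero β}} .{{_ : NonZero s}}
  (out-bound : suc k′ * b ^ suc k′ ≤ eₒ * β ^ k′)
  (in-bound  : suc k′ * a ^ suc k′ ≤ eᵢ * β ^ k′)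
  (star-bound : (suc k′ P′ s) * a ^ suc s ≤ eₛ * β ^ s * s !)
  (balance : β + (eₒ + (eᵢ + (eₛ + 0))) ≤ a + b)
  where
  open Graph G

  k L : ℕ
  k = suc k′
  L = a + b

  Inside Outside : Vec (Fin L) n → Fin n → Set
  Inside  f v = In a (lookup f v)
  Outside f v = ¬ In a (lookup f v)

  inside? : ∀ f → Decidable (Inside f)
  inside? f v = toℕ (lookup f v) <? a

  outside? : ∀ f → Decidable (Outside f)
  outside? f v = ¬? (inside? f v)

  -- The neighborhood of v meets T.
  Meets : (Fin n → Set) → Fin n → Set
  Meets T v = ∃ λ u → v ~ u × T u

  meets? : ∀ {T} → Decidable T → Decidable (Meets T)
  meets? T? v = any? λ u → (v ~? u) ×-dec T? u

  -- φ properly colors the vertices of p that are inside.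
  ProperOn : Subset n → Vec (Fin L) n → (Fin n → Fin s) → Set
  ProperOn p f φ = ∀ u v → u ∈ p → v ∈ p → Inside f u → Inside f v → u ~ v → φ u ≢ φ v

  properOn? : ∀ p f → Decidable (ProperOn p f)
  properOn? p f φ = all? λ u → all? λ v → (u ∈? p) →-dec ((v ∈? p) →-dec
    (inside? f u →-dec (inside? f v →-dec ((u ~? v) →-dec ¬? (φ u ≟ᶠ φ v)))))

  record Good (p : Subset n) (f : Vec (Fin L) n) : Set where
    constructor good
    field
      meets-inside  : ∀ v → Complete G p v → Meets (Inside f) v
      meets-outside : ∀ v → Complete G p v → Meets (Outside f) v
      colorable     : ∃ (ProperOn p f)

  good? : ∀ p → Decidable (Good p)
  good? p f = map′ (λ (i , o , c) → good i o c) (λ (good i o c) → i , o , c)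
    ((all? λ v → complete? G p v →-dec meets? (inside? f) v) ×-dec
     (all? λ v → complete? G p v →-dec meets? (outside? f) v) ×-dec
     ∃-coloring? G (properOn? p f) λ φ≗ψ prop u v u∈ v∈ iu iv u~v φu≡φv →
       prop u v u∈ v∈ iu iv u~v (trans (φ≗ψ u) (trans φu≡φv (sym (φ≗ψ v)))))

  good-⊥ : ∀ f → Good ⊥ f
  good-⊥ f = good (λ v → absurd) (λ v → absurd) ((λ _ → color) , λ u v u∈ → contradiction u∈ ∉⊥)
    where
    absurd : ∀ {A : Set} {v} → Complete G ⊥ v → A
    absurd {v = v} comp = let u , v~u = neighbor G reg v in contradiction (comp u v~u) ∉⊥
    color : ∀ {s} → .{{NonZero s}} → Fin s
    color {suc _} = zero

  good-⊆ : ∀ {p q f} → p ⊆ q → Good q f → Good p f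
  good-⊆ p⊆q (good i o (φ , prop)) = good
    (λ v comp → i v (complete-⊆ G {v = v} p⊆q comp)) (λ v comp → o v (complete-⊆ G {v = v} p⊆q comp))
    (φ , λ u v u∈ v∈ → prop u v (p⊆q u∈) (p⊆q v∈))

  good-local : ∀ {p x} → x ∉ p → Ignores x (Good p)
  good-local {p} {x} x∉p f l (good i o (φ , prop)) = good
    (λ v comp → let u , v~u , inu = i v comp in u , v~u , subst (In a) (sym (same (comp u v~u))) inu)
    (λ v comp → let u , v~u , outu = o v comp in u , v~u , outu ∘ subst (In a) (same (comp u v~u)))
    (φ , λ u v u∈ v∈ iu iv → prop u v u∈ v∈ (subst (In a) (same u∈) iu) (subst (In a) (same v∈) iv))
    where
    same : ∀ {u} → u ∈ p → lookup (f [ x ]≔ l) u ≡ lookup f u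
    same u∈ = lookup∘update′ (λ where refl → x∉p u∈) f l

  -- The labels of x ∷ ys all lie in a fixed set R.
  uniform : ∀ {R : Fin L → Set} (R? : Decidable R) {m ω x} (ys : List (Fin n)) → sum (λ l → 𝟙 (R? l)) ≤ ω →
            Unique (x ∷ ys) → length ys ≡ m → Flaw L m ω x
  uniform {R} R? {x = x} ys R≤ω uniq len = record
    { others   = ys
    ; size     = len
    ; distinct = uniq
    ; Allowed  = λ _ → R
    ; allowed? = λ _ → R?
    ; ignores  = All.universal (λ y l f l′ r → r) (x ∷ ys)
    ; width    = λ _ → R≤ω
    }

  in? : Decidable (In {L} a)
  in? l = toℕ l <? a

  out? : Decidable (λ (l : Fin L) → ¬ In a l)
  out? l = ¬? (toℕ l <? a)

  -- The whole neighborhood of v, which contains x, has its labels in R.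
  around : ∀ {R : Fin L → Set} (R? : Decidable R) {ω x} → sum (λ l → 𝟙 (R? l)) ≤ ω →
           ∀ {v} → v ~ x → Flaw L k′ ω x
  around R? {x = x} R≤ω {v} v~x = uniform R? (except x (neighbors v)) R≤ω
    (except-∉ x (neighbors v) ∷ except-unique x (neighbors-unique G v))
    (cong pred (length-others G reg v~x))

  around-kind : ∀ {R : Fin L → Set} (R? : Decidable R) {ω} e → sum (λ l → 𝟙 (R? l)) ≤ ω →
                k * ω ^ suc k′ ≤ e * β ^ k′ → Kind L n β
  around-kind R? {ω} e R≤ω bound = record
    { cost  = e
    ; flaws = λ x → mapWith∈ (neighbors x) λ v∈ → around R? R≤ω (sym-~ (neighbors-~ G v∈))
    ; bound = λ x → ≤-trans (*-monoˡ-≤ (ω ^ suc k′)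
        (≤-reflexive (length-flaws G reg x (λ v∈ → around R? R≤ω (sym-~ (neighbors-~ G v∈)))))) bound
    }

  around-occurs : ∀ {R : Fin L → Set} (R? : Decidable R) {ω} e (R≤ω : sum (λ l → 𝟙 (R? l)) ≤ ω) bound {p x v f} →
    v ~ x → Complete G p v → (∀ u → v ~ u → R (lookup f u)) →
    Any (λ φ → All (_∈ p ∖ x) (Flaw.others φ) × Flaw.Occurs φ f) (Kind.flaws (around-kind R? e R≤ω bound) x)
  around-occurs R? e R≤ω bound {v = v} v~x comp all-R = Any.mapWith∈⁺ _
    (v , ∈-neighbors G (sym-~ v~x) , others-⊆ G reg {v = v} comp ,
     All.tabulate λ {u} u∈ → all-R u (near G v~x u∈))

  -- x and the vertices of ys, s of its neighbors, are inside.
  star : ∀ {x ys} → ys ⊆ˡ neighbors x × length ys ≡ s → Flaw L s a x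
  star {x} {ys} (ys⊆ , len) = uniform in? ys (in-labels a b)
    (All-resp-⊆ ys⊆ (All.tabulate λ y∈ → ~⇒≢ G (neighbors-~ G y∈)) ∷ Unique-⊆ ys⊆ (neighbors-unique G x))
    len

  -- There are C(k,s) stars at x.
  stars : Kind L n β
  stars = record
    { cost  = eₛ
    ; flaws = λ x → mapWith∈ (choose s (neighbors x)) λ ys∈ → star (All.lookup (choose-⊆ s (neighbors x)) ys∈)
    ; bound = λ x → *-cancelʳ-≤ _ _ (s !) {{s !≢0}} (begin
        length (mapWith∈ (choose s (neighbors x)) λ ys∈ → star (All.lookup (choose-⊆ s (neighbors x)) ys∈)) * a ^ suc s * s !
          ≡⟨ cong (λ c → c * a ^ suc s * s !) (length-mapWith∈ (setoid (List (Fin n))) (choose s (neighbors x))) ⟩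
        length (choose s (neighbors x)) * a ^ suc s * s !
          ≡⟨ swap (length (choose s (neighbors x))) (a ^ suc s) (s !) ⟩
        length (choose s (neighbors x)) * s ! * a ^ suc s
          ≤⟨ *-monoˡ-≤ (a ^ suc s) (length-choose s (neighbors x)) ⟩
        (degree x P′ s) * a ^ suc s
          ≡⟨ cong (λ d → (d P′ s) * a ^ suc s) (reg x) ⟩
        (k P′ s) * a ^ suc s
          ≤⟨ star-bound ⟩
        eₛ * β ^ s * s ! ∎)
    }
    where
    open ≤-Reasoning
    swap : ∀ x y z → x * y * z ≡ x * z * y
    swap = solve-∀

  kinds : List (Kind L n β)
  kinds = around-kind out? eₒ (out-labels a b) out-bound
        ∷ around-kind in?  eᵢ (in-labels a b)  in-bound
        ∷ stars
        ∷ []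

  module _ (p : Subset n) (x : Fin n) (f : Vec (Fin L) n) where

    keep-color : ∀ {φ} → ProperOn (p ∖ x) f φ → Outside f x → ProperOn p f φ
    keep-color prop out u v u∈ v∈ iu iv = prop u v
      (x∈p∧x≢y⇒x∈p-y u∈ λ where refl → out iu) (x∈p∧x≢y⇒x∈p-y v∈ λ where refl → out iv) iu iv

    -- Only these vertices can block a color for x.
    Seen : Fin n → Set
    Seen y = y ∈ p ∖ x × Inside f y

    seen? : Decidable Seen
    seen? y = (y ∈? p ∖ x) ×-dec inside? f y

    -- If fewer than s neighbors are seen, a color is left for x.
    recolor : ∀ {φ} → ProperOn (p ∖ x) f φ → length (filter seen? (neighbors x)) < s → ∃ (ProperOn p f)
    recolor {φ} prop few = ψ , proper
      where
      free = missing (map φ (filter seen? (neighbors x)))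
               (subst (_< s) (sym (length-map φ (filter seen? (neighbors x)))) few)
      j = proj₁ free
      ψ : Fin n → Fin s
      ψ u with u ≟ᶠ x
      ... | yes _ = j
      ... | no _  = φ u
      unseen : ∀ {v} → v ∈ p → v ≢ x → Inside f v → x ~ v → φ v ≢ j
      unseen {v} v∈ v≢x iv x~v φv≡j = proj₂ free (subst (_∈ˡ _) φv≡j
        (∈-map⁺ φ (∈-filter⁺ seen? (∈-neighbors G x~v) (x∈p∧x≢y⇒x∈p-y v∈ v≢x , iv))))
      proper : ProperOn p f ψ
      proper u v u∈ v∈ iu iv u~v with u ≟ᶠ x | v ≟ᶠ x
      ... | yes refl | yes refl = contradiction refl (~⇒≢ G u~v)
      ... | yes refl | no v≢x   = ≢-sym (unseen v∈ v≢x iv u~v)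
      ... | no u≢x   | yes refl = unseen u∈ u≢x iu (sym-~ u~v)
      ... | no u≢x   | no v≢x   = prop u v (x∈p∧x≢y⇒x∈p-y u∈ u≢x) (x∈p∧x≢y⇒x∈p-y v∈ v≢x) iu iv u~v

    -- Only neighborhoods through x are new.
    meets-all : ∀ {T} → Decidable T → (∀ v → Complete G (p ∖ x) v → Meets T v) →
                ¬ (∃ λ v → v ~ x × Complete G p v × ¬ Meets T v) → ∀ v → Complete G p v → Meets T v
    meets-all T? old none v comp with v ~? x
    ... | no v≁x  = old v (complete-- G {v = v} v≁x comp)
    ... | yes v~x = decidable-stable (meets? T? v) λ ¬meets → none (v , v~x , comp , ¬meets)

  star-occurs : ∀ p {x f} → Inside f x → s ≤ length (filter (seen? p x f) (neighbors x)) →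
    Any (λ φ → All (_∈ p ∖ x) (Flaw.others φ) × Flaw.Occurs φ f) (Kind.flaws stars x)
  star-occurs p {x} {f} ix many =
    let ys , ys∈ , seen = find (choose-satisfying (seen? p x f) s (neighbors x) many) in
    Any.mapWith∈⁺ _ (ys , ys∈ , All.map proj₁ seen , ix ∷ All.map proj₂ seen)

  defect : ∀ {p x f} → x ∈ p → Good (p ∖ x) f → ¬ Good p f →
    Any (λ κ → Any (λ φ → All (_∈ p ∖ x) (Flaw.others φ) × Flaw.Occurs φ f) (Kind.flaws κ x)) kinds
  defect {p} {x} {f} x∈p (good i o (φ , prop)) ¬good
    with any? (λ v → (v ~? x) ×-dec complete? G p v ×-dec ¬? (meets? (inside? f) v))
       | any? (λ v → (v ~? x) ×-dec complete? G p v ×-dec ¬? (meets? (outside? f) v))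
  ... | yes (v , v~x , comp , ¬in) | _ =
    here (around-occurs out? eₒ (out-labels a b) out-bound {v = v} v~x comp
      λ u v~u iu → ¬in (u , v~u , iu))
  ... | no _ | yes (v , v~x , comp , ¬out) =
    there (here (around-occurs in? eᵢ (in-labels a b) in-bound {v = v} v~x comp
      λ u v~u → decidable-stable (inside? f u) λ ou → ¬out (u , v~u , ou)))
  ... | no ins | no outs with inside? f x | s ≤? length (filter (seen? p x f) (neighbors x))
  ...   | yes ix | yes many = there (there (here (star-occurs p ix many)))
  ...   | yes _  | no ¬many = contradiction
    (good (meets-all p x f (inside? f) i ins) (meets-all p x f (outside? f) o outs)
      (recolor p x f prop (≰⇒> ¬many))) ¬good
  ...   | no ox  | _        = contradiction
    (good (meets-all p x f (inside? f) i ins) (meets-all p x f (outside? f) o outs)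
      (φ , keep-color p x f prop ox)) ¬good

  dynamicColorable : ∀ {l} → Colorable G l → DynamicColorable G (l + s)
  dynamicColorable {l} (c , c-proper) =
    let f , good i o (φ , φ-proper) =
          Growth.good-exists Good good? good-⊥ (λ {p} {q} {f} → good-⊆ {p} {q} {f}) good-local β kinds balance defect
    in coloring f φ , proper f φ φ-proper , λ v _ →
       let u , v~u , iu = i v (complete-⊤ G v)
           w , v~w , ow = o v (complete-⊤ G v)
       in u , w , v~u , v~w , apart f φ iu ow
    where
    -- New colors on the vertices that are in, old colors elsewhere.
    coloring : Vec (Fin L) n → (Fin n → Fin s) → Fin n → Fin (l + s)
    coloring f φ v with inside? f v
    ... | yes _ = l ↑ʳ φ v
    ... | no _  = c v ↑ˡ s
    ↑ˡ≢↑ʳ : ∀ (i : Fin l) (j : Fin s) → i ↑ˡ s ≢ l ↑ʳ j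
    ↑ˡ≢↑ʳ i j eq with trans (sym (splitAt-↑ˡ l i s)) (trans (cong (splitAt l) eq) (splitAt-↑ʳ l s j))
    ... | ()
    apart : ∀ f φ {u w} → Inside f u → Outside f w → coloring f φ u ≢ coloring f φ w
    apart f φ {u} {w} iu ow with inside? f u | inside? f w
    ... | yes _ | no _   = ↑ˡ≢↑ʳ (c w) (φ u) ∘ sym
    ... | no ou | _      = contradiction iu ou
    ... | _     | yes iw = contradiction iw ow
    proper : ∀ f φ → ProperOn ⊤ f φ → Proper G (coloring f φ)
    proper f φ φ-proper u v u~v with inside? f u | inside? f v
    ... | yes iu | yes iv = φ-proper u v ∈⊤ ∈⊤ iu iv u~v ∘ ↑ʳ-injective l (φ u) (φ v)
    ... | yes _  | no _   = ↑ˡ≢↑ʳ (c v) (φ u) ∘ sym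
    ... | no _   | yes _  = ↑ˡ≢↑ʳ (c u) (φ v)
    ... | no _   | no _   = c-proper u v u~v ∘ ↑ˡ-injective s (c u) (c v)

-- Means and compound growth

module _ where

  open ≤-Reasoning

  ^-distrib-* : ∀ o m n → (m * n) ^ o ≡ m ^ o * n ^ o
  ^-distrib-* zero    m n = refl
  ^-distrib-* (suc o) m n = trans (cong (m * n *_) (^-distrib-* o m n)) (interchange m n (m ^ o) (n ^ o))
    where
    interchange : ∀ a b c d → a * b * (c * d) ≡ a * c * (b * d)
    interchange = solve-∀

  2xy≤x²+y² : ∀ x y → 2 * (x * y) ≤ x * x + y * y
  2xy≤x²+y² x y =
    [ ordered , (λ y≤x → subst₂ _≤_ (cong (2 *_) (*-comm y x)) (+-comm (y * y) (x * x)) (ordered y≤x)) ]′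
      (≤-total x y)
    where
    square : ∀ x d → x * x + (x + d) * (x + d) ≡ 2 * (x * (x + d)) + d * d
    square = solve-∀
    ordered : ∀ {x y} → x ≤ y → 2 * (x * y) ≤ x * x + y * y
    ordered {x} x≤y with m≤n⇒∃[o]m+o≡n x≤y
    ... | d , refl = ≤-trans (m≤m+n _ (d * d)) (≤-reflexive (sym (square x d)))

  -- Young's inequality with integral exponents.
  young : ∀ j x y → suc j * (x * y ^ j) ≤ x ^ suc j + j * y ^ suc j
  young zero    x y = ≤-reflexive (unit x)
    where
    unit : ∀ x → 1 * (x * 1) ≡ x * 1 + 0
    unit = solve-∀
  young (suc j) x y = +-cancelˡ-≤ (j * (x * y * z)) _ _ (begin
    j * (x * y * z) + suc (suc j) * (x * (y * z))
      ≡⟨ split j x y z ⟩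
    suc j * (2 * (x * y)) * z
      ≤⟨ *-monoˡ-≤ z (*-monoʳ-≤ (suc j) (2xy≤x²+y² x y)) ⟩
    suc j * (x * x + y * y) * z
      ≡⟨ regroup j x y z ⟩
    x * (suc j * (x * z)) + suc j * (y * (y * z))
      ≤⟨ +-monoˡ-≤ _ (*-monoʳ-≤ x (young j x y)) ⟩
    x * (x ^ suc j + j * y ^ suc j) + suc j * (y * (y * z))
      ≡⟨ collect j x y z (x ^ suc j) ⟩
    j * (x * y * z) + (x * x ^ suc j + suc j * (y * (y * z))) ∎)
    where
    z = y ^ j
    split : ∀ j x y z → j * (x * y * z) + suc (suc j) * (x * (y * z)) ≡ suc j * (2 * (x * y)) * z
    split = solve-∀
    regroup : ∀ j x y z → suc j * (x * x + y * y) * z ≡ x * (suc j * (x * z)) + suc j * (y * (y * z))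
    regroup = solve-∀
    collect : ∀ j x y z w → x * (w + j * (y * z)) + suc j * (y * (y * z)) ≡
                            j * (x * y * z) + (x * w + suc j * (y * (y * z)))
    collect = solve-∀

  -- The inequality of arithmetic and geometric means for k copies of u and one v,
  -- obtained from Young's inequality for x = k u + v and y = (k + 1) u.
  am-gm : ∀ k u v → suc k ^ suc k * (u ^ k * v) ≤ (k * u + v) ^ suc k
  am-gm k u v = +-cancelˡ-≤ (k * y ^ suc k) _ _ (begin
    k * y ^ suc k + suc k ^ suc k * (u ^ k * v)
      ≡⟨ cong (λ z → k * (y * z) + suc k ^ suc k * (u ^ k * v)) (^-distrib-* k (suc k) u) ⟩
    k * (y * (suc k ^ k * u ^ k)) + suc k ^ suc k * (u ^ k * v)
      ≡⟨ regroup k u v (suc k ^ k) (u ^ k) ⟩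
    suc k * ((k * u + v) * (suc k ^ k * u ^ k))
      ≡⟨ cong (λ z → suc k * ((k * u + v) * z)) (^-distrib-* k (suc k) u) ⟨
    suc k * ((k * u + v) * y ^ k)
      ≤⟨ young k (k * u + v) y ⟩
    (k * u + v) ^ suc k + k * y ^ suc k
      ≡⟨ +-comm ((k * u + v) ^ suc k) _ ⟩
    k * y ^ suc k + (k * u + v) ^ suc k ∎)
    where
    y = suc k * u
    regroup : ∀ k u v p q → k * (suc k * u * (p * q)) + suc k * p * (q * v) ≡ suc k * ((k * u + v) * (p * q))
    regroup = solve-∀

  -- If X / Y does not decrease in one step, then it does not in several.
  ratio-mono : (X Y : ℕ → ℕ) → ∀ {i} → (∀ j → i ≤ j → NonZero (Y j)) →
               (∀ j → i ≤ j → X j * Y (suc j) ≤ X (suc j) * Y j) →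
               ∀ {j} → i ≤′ j → X i * Y j ≤ X j * Y i
  ratio-mono X Y Y≢0 step ≤′-refl = ≤-refl
  ratio-mono X Y {i} Y≢0 step (≤′-step {j} i≤j) = *-cancelˡ-≤ (Y j) {{Y≢0 j (≤′⇒≤ i≤j)}} (begin
    Y j * (X i * Y (suc j))   ≡⟨ swap₁ (Y j) (X i) (Y (suc j)) ⟩
    X i * Y j * Y (suc j)     ≤⟨ *-monoˡ-≤ (Y (suc j)) (ratio-mono X Y Y≢0 step i≤j) ⟩
    X j * Y i * Y (suc j)     ≡⟨ swap₂ (X j) (Y i) (Y (suc j)) ⟩
    X j * Y (suc j) * Y i     ≤⟨ *-monoˡ-≤ (Y i) (step j (≤′⇒≤ i≤j)) ⟩
    X (suc j) * Y j * Y i     ≡⟨ swap₃ (X (suc j)) (Y j) (Y i) ⟩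
    Y j * (X (suc j) * Y i)   ∎)
    where
    swap₁ : ∀ a b c → a * (b * c) ≡ b * a * c
    swap₁ = solve-∀
    swap₂ : ∀ a b c → a * b * c ≡ a * c * b
    swap₂ = solve-∀
    swap₃ : ∀ a b c → a * b * c ≡ b * (a * c)
    swap₃ = solve-∀

  -- (1 + C/(B k)) ^ k does not decrease with k: apply the mean inequality to k copies
  -- of 1 + C/(B k) and one 1.
  compound-mono : ∀ B C .{{_ : NonZero B}} {j k} .{{_ : NonZero j}} → j ≤ k →
                  (B * j + C) ^ j * (B * k) ^ k ≤ (B * k + C) ^ k * (B * j) ^ j
  compound-mono B C {{B≢0}} {j} j≤k = ratio-mono (λ k → (B * k + C) ^ k) (λ k → (B * k) ^ k)
    (λ i j≤i → m^n≢0 (B * i) i {{m*n≢0 B i {{B≢0}} {{≢0 j≤i}}}}) (λ i j≤i → step i {{≢0 j≤i}}) (≤⇒≤′ j≤k)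
    where
    ≢0 : ∀ {i} → j ≤ i → NonZero i
    ≢0 j≤i = >-nonZero (<-≤-trans (>-nonZero⁻¹ j) j≤i)
    step : ∀ k .{{_ : NonZero k}} → (B * k + C) ^ k * (B * suc k) ^ suc k ≤ (B * suc k + C) ^ suc k * (B * k) ^ k
    step k = *-cancelˡ-≤ k (begin
      k * ((B * k + C) ^ k * (B * suc k) ^ suc k)
        ≡⟨ cong (λ z → k * ((B * k + C) ^ k * z)) (^-distrib-* (suc k) B (suc k)) ⟩
      k * (p * (B * B ^ k * suc k ^ suc k))
        ≡⟨ regroup₁ k p B (B ^ k) (suc k ^ suc k) ⟩
      B ^ k * (suc k ^ suc k * (p * (B * k)))
        ≤⟨ *-monoʳ-≤ (B ^ k) (am-gm k (B * k + C) (B * k)) ⟩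
      B ^ k * (k * (B * k + C) + B * k) ^ suc k
        ≡⟨ cong (λ z → B ^ k * z ^ suc k) (mean k B C) ⟩
      B ^ k * (k * (B * suc k + C)) ^ suc k
        ≡⟨ cong (B ^ k *_) (^-distrib-* (suc k) k (B * suc k + C)) ⟩
      B ^ k * (k * k ^ k * q)
        ≡⟨ regroup₂ (B ^ k) k (k ^ k) q ⟩
      k * (q * (B ^ k * k ^ k))
        ≡⟨ cong (λ z → k * (q * z)) (^-distrib-* k B k) ⟨
      k * (q * (B * k) ^ k) ∎)
      where
      p = (B * k + C) ^ k
      q = (B * suc k + C) ^ suc k
      mean : ∀ k B C → k * (B * k + C) + B * k ≡ k * (B * suc k + C)
      mean = solve-∀
      regroup₁ : ∀ k p B Bᵏ K → k * (p * (B * Bᵏ * K)) ≡ Bᵏ * (K * (p * (B * k)))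
      regroup₁ = solve-∀
      regroup₂ : ∀ Bᵏ k kᵏ q → Bᵏ * (k * kᵏ * q) ≡ k * (q * (Bᵏ * kᵏ))
      regroup₂ = solve-∀

  -- (1 + 1/n) ^ (n + 1) decreases with n: apply the mean inequality to n + 1 copies of
  -- n/(n + 1) and one 1.
  euler-anti : ∀ {i n} .{{_ : NonZero i}} → i ≤ n → i ^ suc i * suc n ^ suc n ≤ n ^ suc n * suc i ^ suc i
  euler-anti i≤n = ratio-mono (λ n → n ^ suc n) (λ n → suc n ^ suc n) (λ j _ → m^n≢0 (suc j) (suc j))
    (λ j _ → step j) (≤⇒≤′ i≤n)
    where
    step : ∀ n → n ^ suc n * suc (suc n) ^ suc (suc n) ≤ suc n ^ suc (suc n) * suc n ^ suc n
    step n = *-cancelˡ-≤ (suc n) (begin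
      suc n * (n ^ suc n * suc (suc n) ^ suc (suc n))
        ≡⟨ regroup (suc n) (n ^ suc n) (suc (suc n) ^ suc (suc n)) ⟩
      suc (suc n) ^ suc (suc n) * (n ^ suc n * suc n)
        ≤⟨ am-gm (suc n) n (suc n) ⟩
      (suc n * n + suc n) ^ suc (suc n)
        ≡⟨ cong (_^ suc (suc n)) (square n) ⟩
      (suc n * suc n) ^ suc (suc n)
        ≡⟨ ^-distrib-* (suc (suc n)) (suc n) (suc n) ⟩
      suc n ^ suc (suc n) * (suc n * suc n ^ suc n)
        ≡⟨ swap (suc n ^ suc (suc n)) (suc n) (suc n ^ suc n) ⟩
      suc n * (suc n ^ suc (suc n) * suc n ^ suc n) ∎)
      where
      regroup : ∀ a b c → a * (b * c) ≡ c * (b * a)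
      regroup = solve-∀
      swap : ∀ a b c → a * (b * c) ≡ b * (a * c)
      swap = solve-∀
      square : ∀ n → suc n * n + suc n ≡ suc n * suc n
      square = solve-∀

  -- If (1 + 1/i) ^ (i + 1) ≤ 30/11, then (1 + 1/s) ^ s ≤ 30/11 for all s.  With
  -- n = s + i, both are compared with the value at n.
  euler-bound-from : ∀ i .{{_ : NonZero i}} → T (11 * suc i ^ suc i ≤ᵇ 30 * i ^ suc i) →
                     ∀ s .{{_ : NonZero s}} → 11 * suc s ^ s ≤ 30 * s ^ s
  euler-bound-from i at-i s = *-cancelʳ-≤ _ _ (n ^ n) {{m^n≢0 n n}} (begin
    11 * suc s ^ s * n ^ n           ≡⟨ *-assoc 11 (suc s ^ s) (n ^ n) ⟩
    11 * (suc s ^ s * n ^ n)         ≤⟨ *-monoʳ-≤ 11 increasing ⟩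
    11 * (suc n ^ n * s ^ s)         ≡⟨ *-assoc 11 (suc n ^ n) (s ^ s) ⟨
    11 * suc n ^ n * s ^ s           ≤⟨ *-monoˡ-≤ (s ^ s) large ⟩
    30 * n ^ n * s ^ s               ≡⟨ swap (n ^ n) (s ^ s) ⟩
    30 * s ^ s * n ^ n               ∎)
    where
    n = s + i
    instance
      n≢0 : NonZero n
      n≢0 = >-nonZero (<-≤-trans (>-nonZero⁻¹ i) (m≤n+m i s))
    swap : ∀ a b → 30 * a * b ≡ 30 * b * a
    swap = solve-∀
    increasing : suc s ^ s * n ^ n ≤ suc n ^ n * s ^ s
    increasing = subst₂ _≤_
      (cong₂ (λ x y → x ^ s * y ^ n) (plus-one s) (*-identityˡ n))
      (cong₂ (λ x y → x ^ n * y ^ s) (plus-one n) (*-identityˡ s))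
      (compound-mono 1 1 (m≤m+n s i))
      where
      plus-one : ∀ s → 1 * s + 1 ≡ suc s
      plus-one = solve-∀
    transfer : ∀ {x y p q} .{{_ : NonZero p}} → p * x ≤ y * q → 11 * q ≤ 30 * p → 11 * x ≤ 30 * y
    transfer {x} {y} {p} {q} px≤yq 11q≤30p = *-cancelˡ-≤ p (begin
      p * (11 * x)   ≡⟨ r₁ p x ⟩
      11 * (p * x)   ≤⟨ *-monoʳ-≤ 11 px≤yq ⟩
      11 * (y * q)   ≡⟨ r₂ y q ⟩
      y * (11 * q)   ≤⟨ *-monoʳ-≤ y 11q≤30p ⟩
      y * (30 * p)   ≡⟨ r₃ y p ⟩
      p * (30 * y)   ∎)
      where
      r₁ : ∀ p x → p * (11 * x) ≡ 11 * (p * x)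
      r₁ = solve-∀
      r₂ : ∀ y q → 11 * (y * q) ≡ y * (11 * q)
      r₂ = solve-∀
      r₃ : ∀ y p → y * (30 * p) ≡ p * (30 * y)
      r₃ = solve-∀
    large : 11 * suc n ^ n ≤ 30 * n ^ n
    large = *-cancelˡ-≤ (suc n) (begin
      suc n * (11 * suc n ^ n)   ≡⟨ r₁ (suc n) (suc n ^ n) ⟩
      11 * suc n ^ suc n         ≤⟨ transfer {suc n ^ suc n} {n ^ suc n} {i ^ suc i} {suc i ^ suc i} {{m^n≢0 i (suc i)}}
                                      (euler-anti (m≤n+m i s)) (≤ᵇ⇒≤ (11 * suc i ^ suc i) (30 * i ^ suc i) at-i) ⟩
      30 * n ^ suc n             ≤⟨ *-monoʳ-≤ 30 (*-monoˡ-≤ (n ^ n) (n≤1+n n)) ⟩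
      30 * (suc n * n ^ n)       ≡⟨ r₂ (suc n) (n ^ n) ⟩
      suc n * (30 * n ^ n)       ∎)
      where
      r₁ : ∀ a b → a * (11 * b) ≡ 11 * (a * b)
      r₁ = solve-∀
      r₂ : ∀ a b → 30 * (a * b) ≡ a * (30 * b)
      r₂ = solve-∀

  -- As 30/11 slightly exceeds e, a large i such as 200 passes the test.
  euler-bound : ∀ s .{{_ : NonZero s}} → 11 * suc s ^ s ≤ 30 * s ^ s
  euler-bound = euler-bound-from 200 _

  -- Admissible weights

  -- Weights meeting the hypotheses of InOut for degree k′ + 1 and s new colors.
  record Admissible (k′ s : ℕ) : Set where
    field
      a b β eₒ eᵢ eₛ : ℕ
      β≢0        : NonZero β
      out-bound  : suc k′ * b ^ suc k′ ≤ eₒ * β ^ k′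
      in-bound   : suc k′ * a ^ suc k′ ≤ eᵢ * β ^ k′
      star-bound : (suc k′ P′ s) * a ^ suc s ≤ eₛ * β ^ s * s !
      balance    : β + (eₒ + (eᵢ + (eₛ + 0))) ≤ a + b

  -- The weights a = A and b = B k, with growth rate B k + C.
  module Scaled (k′ s A B C eₒ eᵢ eₛ : ℕ) .{{_ : NonZero B}} where

    k β : ℕ
    k = suc k′
    β = B * k + C

    β≢0 : NonZero β
    β≢0 = >-nonZero (<-≤-trans (>-nonZero⁻¹ (B * k) {{m*n≢0 B k}}) (m≤m+n (B * k) C))

    admissible : k * β * (B * k) ^ k ≤ eₒ * β ^ k →
                 2 * A ≤ β → k * A ≤ eᵢ * 2 ^ k′ →
                 (k P′ s) * A ^ suc s ≤ eₛ * β ^ s * s ! →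
                 C + (eₒ + (eᵢ + (eₛ + 0))) ≤ A →
                 Admissible k′ s
    admissible out 2A≤β kA≤ star budget = record
      { a = A ; b = B * k ; β = β ; eₒ = eₒ ; eᵢ = eᵢ ; eₛ = eₛ ; β≢0 = β≢0
      ; out-bound = *-cancelˡ-≤ β {{β≢0}} (begin
          β * (k * (B * k) ^ k)   ≡⟨ swap β k ((B * k) ^ k) ⟩
          k * β * (B * k) ^ k     ≤⟨ out ⟩
          eₒ * (β * β ^ k′)       ≡⟨ swap′ eₒ β (β ^ k′) ⟩
          β * (eₒ * β ^ k′)       ∎)
      ; in-bound = begin
          k * (A * A ^ k′)         ≡⟨ *-assoc k A (A ^ k′) ⟨
          k * A * A ^ k′           ≤⟨ *-monoˡ-≤ (A ^ k′) kA≤ ⟩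
          eᵢ * 2 ^ k′ * A ^ k′     ≡⟨ *-assoc eᵢ (2 ^ k′) (A ^ k′) ⟩
          eᵢ * (2 ^ k′ * A ^ k′)   ≡⟨ cong (eᵢ *_) (^-distrib-* k′ 2 A) ⟨
          eᵢ * (2 * A) ^ k′        ≤⟨ *-monoʳ-≤ eᵢ (^-monoˡ-≤ k′ 2A≤β) ⟩
          eᵢ * β ^ k′              ∎
      ; star-bound = star
      ; balance = begin
          B * k + C + (eₒ + (eᵢ + (eₛ + 0)))     ≡⟨ +-assoc (B * k) C _ ⟩
          B * k + (C + (eₒ + (eᵢ + (eₛ + 0))))   ≤⟨ +-monoʳ-≤ (B * k) budget ⟩
          B * k + A                              ≡⟨ +-comm (B * k) A ⟩
          A + B * k                              ∎
      }
      where
      swap : ∀ x y z → x * (y * z) ≡ y * x * z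
      swap = solve-∀
      swap′ : ∀ x y z → x * (y * z) ≡ y * (x * z)
      swap′ = solve-∀

    -- The out bound amounts to k (B k + C) ≤ eₒ (1 + C/(B k)) ^ k.  In the power, k may be
  -- replaced by a smaller j.
    out-from : ∀ {j} .{{_ : NonZero j}} → j ≤ k → k * β * (B * j) ^ j ≤ eₒ * (B * j + C) ^ j →
               k * β * (B * k) ^ k ≤ eₒ * β ^ k
    out-from {j} j≤k at-j = *-cancelʳ-≤ _ _ ((B * j + C) ^ j) {{m^n≢0 (B * j + C) j {{Bj+C≢0}}}} (begin
      k * β * (B * k) ^ k * (B * j + C) ^ j     ≡⟨ r₁ (k * β) _ _ ⟩
      k * β * ((B * j + C) ^ j * (B * k) ^ k)   ≤⟨ *-monoʳ-≤ (k * β) (compound-mono B C j≤k) ⟩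
      k * β * (β ^ k * (B * j) ^ j)             ≡⟨ r₂ (k * β) _ _ ⟩
      k * β * (B * j) ^ j * β ^ k               ≤⟨ *-monoˡ-≤ (β ^ k) at-j ⟩
      eₒ * (B * j + C) ^ j * β ^ k              ≡⟨ r₃ eₒ _ _ ⟩
      eₒ * β ^ k * (B * j + C) ^ j              ∎)
      where
      Bj+C≢0 : NonZero (B * j + C)
      Bj+C≢0 = >-nonZero (<-≤-trans (>-nonZero⁻¹ (B * j) {{m*n≢0 B j}}) (m≤m+n (B * j) C))
      r₁ : ∀ x y z → x * y * z ≡ x * (z * y)
      r₁ = solve-∀
      r₂ : ∀ x y z → x * (y * z) ≡ x * z * y
      r₂ = solve-∀
      r₃ : ∀ x y z → x * y * z ≡ x * z * y
      r₃ = solve-∀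

  -- Each factor (k - i) / (B k + C) of the quotient increases with k.
  P′-ratio-mono : ∀ B C s {k l} → k ≤ l → (k P′ s) * (B * l + C) ^ s ≤ (l P′ s) * (B * k + C) ^ s
  P′-ratio-mono B C zero    k≤l = ≤-refl
  P′-ratio-mono B C (suc s) {k} {l} k≤l = begin
    (k ∸ s) * (k P′ s) * ((B * l + C) * (B * l + C) ^ s)
      ≡⟨ interchange (k ∸ s) (k P′ s) (B * l + C) _ ⟩
    (k ∸ s) * (B * l + C) * ((k P′ s) * (B * l + C) ^ s)
      ≤⟨ *-mono-≤ (factor (≤-total s k)) (P′-ratio-mono B C s k≤l) ⟩
    (l ∸ s) * (B * k + C) * ((l P′ s) * (B * k + C) ^ s)
      ≡⟨ interchange (l ∸ s) (B * k + C) (l P′ s) _ ⟩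
    (l ∸ s) * (l P′ s) * ((B * k + C) * (B * k + C) ^ s) ∎
    where
    interchange : ∀ a b c d → a * b * (c * d) ≡ a * c * (b * d)
    interchange = solve-∀
    expand : ∀ B C i d s → (i + d) * (B * (s + i) + C) ≡ i * (B * (s + i + d) + C) + d * (B * s + C)
    expand = solve-∀
    factor : s ≤ k ⊎ k ≤ s → (k ∸ s) * (B * l + C) ≤ (l ∸ s) * (B * k + C)
    factor (inj₂ k≤s) rewrite m≤n⇒m∸n≡0 k≤s = z≤n
    factor (inj₁ s≤k) with m≤n⇒∃[o]m+o≡n s≤k
    ... | i , refl with m≤n⇒∃[o]m+o≡n k≤l
    ... | d , refl = begin
      (s + i ∸ s) * (B * (s + i + d) + C)
        ≡⟨ cong (_* (B * (s + i + d) + C)) (m+n∸m≡n s i) ⟩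
      i * (B * (s + i + d) + C)
        ≤⟨ m≤m+n _ (d * (B * s + C)) ⟩
      i * (B * (s + i + d) + C) + d * (B * s + C)
        ≡⟨ expand B C i d s ⟨
      (i + d) * (B * (s + i) + C)
        ≡⟨ cong (_* (B * (s + i) + C)) (trans (cong (_∸ s) (+-assoc s i d)) (m+n∸m≡n s (i + d))) ⟨
      (s + i + d ∸ s) * (B * (s + i) + C) ∎

  P′-≤-^ : ∀ n s → n P′ s ≤ n ^ s
  P′-≤-^ n zero    = ≤-refl
  P′-≤-^ n (suc s) = *-mono-≤ (m∸n≤m n s) (P′-≤-^ n s)

  -- Doubling outgrows n c ≤ e 2 ^ (n - 1) from any j on.
  n*c≤e*2^ : ∀ {j c e k} → j * c ≤ e * 2 ^ pred j → .{{NonZero j}} → j ≤′ k → k * c ≤ e * 2 ^ pred k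
  n*c≤e*2^ jc≤ ≤′-refl = jc≤
  n*c≤e*2^ {c = c} {e} {suc k} jc≤ (≤′-step j≤k) = begin
    c + k * c              ≤⟨ +-monoˡ-≤ (k * c) (≤-trans (≤-reflexive (sym (*-identityˡ c))) (*-monoˡ-≤ c 1≤k)) ⟩
    k * c + k * c          ≤⟨ +-mono-≤ ih ih ⟩
    e * 2 ^ pred k + e * 2 ^ pred k   ≡⟨ double e (2 ^ pred k) ⟩
    e * 2 ^ suc (pred k)   ≡⟨ cong (λ i → e * 2 ^ i) (suc-pred k {{>-nonZero 1≤k}}) ⟩
    e * 2 ^ k              ∎
    where
    ih = n*c≤e*2^ {c = c} {e} jc≤ j≤k
    1≤k : 1 ≤ k
    1≤k = ≤-trans (>-nonZero⁻¹ _) (≤′⇒≤ j≤k)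
    double : ∀ e p → e * p + e * p ≡ e * (2 * p)
    double = solve-∀

  -- m is the integer part of the logarithm of k to the base 13/11.
  record Log (m k : ℕ) : Set where
    constructor bracket
    field
      lower : 13 ^ m ≤ k * 11 ^ m
      upper : k * 11 ^ suc m < 13 ^ suc m

  allBelow : (ℕ → Bool) → ℕ → Bool
  allBelow f zero    = true
  allBelow f (suc i) = f i ∧ allBelow f i

  allBelow-sound : ∀ f {i n} → T (allBelow f n) → i <′ n → T (f i)
  allBelow-sound f {i} ok ≤′-refl = proj₁ (Equivalence.to T-∧ ok)
  allBelow-sound f {n = suc n} ok (≤′-step i<n) = allBelow-sound f (proj₂ (Equivalence.to (T-∧ {f n}) ok)) i<n

  -- Degrees in a bounded range

  -- Parameters depending on s, to be tested for the finitely many values of m = s - 2 in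
  -- a range.
  module Range (A C : ℕ → ℕ) (B eₒ eᵢ eₛ : ℕ) .{{_ : NonZero B}} where

    -- The integer part of (13/11) ^ m.
    quotient : ℕ → ℕ
    quotient m = (13 ^ m) ℕ./ (11 ^ m)
      where instance _ = m^n≢0 11 m

    -- These inequalities, evaluated at the endpoints, suffice for all k with j ≤ k ≤ l.
    test : (s j l A C : ℕ) → Bool
    test s j l A C =
      (1 ≤ᵇ j) ∧ (l * (B * l + C) * (B * j) ^ j ≤ᵇ eₒ * (B * j + C) ^ j) ∧
      (2 * A ≤ᵇ B * j + C) ∧ (j * A ≤ᵇ eᵢ * 2 ^ pred j) ∧
      ((l P′ s) * A ^ suc s ≤ᵇ eₛ * (B * l + C) ^ s * s !) ∧
      (C + (eₒ + (eᵢ + (eₛ + 0))) ≤ᵇ A)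

    test-sound : ∀ s j l A C {k′} → T (test s j l A C) → j ≤ suc k′ → suc k′ ≤ l → Admissible k′ s
    test-sound s j l A C {k′} ok j≤k k≤l
      with 1≤ᵇj , ok ← Equivalence.to (T-∧ {1 ≤ᵇ j}) ok
      with out , ok ← Equivalence.to (T-∧ {l * (B * l + C) * (B * j) ^ j ≤ᵇ eₒ * (B * j + C) ^ j}) ok
      with 2A≤ , ok ← Equivalence.to (T-∧ {2 * A ≤ᵇ B * j + C}) ok
      with jA≤ , ok ← Equivalence.to (T-∧ {j * A ≤ᵇ eᵢ * 2 ^ pred j}) ok
      with star , budget ← Equivalence.to (T-∧ {(l P′ s) * A ^ suc s ≤ᵇ eₛ * (B * l + C) ^ s * s !}) ok
      = admissible
        (out-from j≤k (≤-trans (*-monoˡ-≤ ((B * j) ^ j) (*-mono-≤ k≤l β≤))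
          (≤ᵇ⇒≤ (l * (B * l + C) * (B * j) ^ j) (eₒ * (B * j + C) ^ j) out)))
        (≤-trans (≤ᵇ⇒≤ (2 * A) (B * j + C) 2A≤) (+-monoˡ-≤ C (*-monoʳ-≤ B j≤k)))
        (n*c≤e*2^ {j} {A} {eᵢ} {k} (≤ᵇ⇒≤ (j * A) (eᵢ * 2 ^ pred j) jA≤) (≤⇒≤′ j≤k))
        (*-cancelʳ-≤ _ _ ((B * l + C) ^ s) {{m^n≢0 (B * l + C) s {{Bl+C≢0}}}} (begin
          (k P′ s) * A ^ suc s * (B * l + C) ^ s     ≡⟨ r₁ (k P′ s) _ _ ⟩
          (k P′ s) * (B * l + C) ^ s * A ^ suc s     ≤⟨ *-monoˡ-≤ (A ^ suc s) (P′-ratio-mono B C s k≤l) ⟩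
          (l P′ s) * (B * k + C) ^ s * A ^ suc s     ≡⟨ r₁ (l P′ s) _ _ ⟩
          (l P′ s) * A ^ suc s * (B * k + C) ^ s     ≤⟨ *-monoˡ-≤ (β ^ s)
                                                        (≤ᵇ⇒≤ ((l P′ s) * A ^ suc s) (eₛ * (B * l + C) ^ s * s !) star) ⟩
          eₛ * (B * l + C) ^ s * s ! * (B * k + C) ^ s   ≡⟨ r₂ eₛ _ (s !) _ ⟩
          eₛ * (B * k + C) ^ s * s ! * (B * l + C) ^ s   ∎))
        (≤ᵇ⇒≤ (C + (eₒ + (eᵢ + (eₛ + 0)))) A budget)
      where
      open Scaled k′ s A B C eₒ eᵢ eₛ
      instance
        j≢0 : NonZero j
        j≢0 = >-nonZero (≤ᵇ⇒≤ 1 j 1≤ᵇj)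
      β≤ : β ≤ B * l + C
      β≤ = +-monoˡ-≤ C (*-monoʳ-≤ B k≤l)
      Bl+C≢0 : NonZero (B * l + C)
      Bl+C≢0 = >-nonZero (<-≤-trans (>-nonZero⁻¹ β {{β≢0}}) β≤)
      r₁ : ∀ x y z → x * y * z ≡ x * z * y
      r₁ = solve-∀
      r₂ : ∀ x y z w → x * y * z * w ≡ x * w * z * y
      r₂ = solve-∀

    -- The test for m = m₀ + i.
    check : ℕ → ℕ → Bool
    check m₀ i = test (2 + m) (quotient m) (quotient (suc m)) (A (2 + m)) (C (2 + m))
      where m = m₀ + i

    admissible : ∀ m₀ n → T (allBelow (check m₀) n) →
                 ∀ {m k′} → m₀ ≤ m → m < m₀ + n → Log m (suc k′) → Admissible k′ (2 + m)
    admissible m₀ n ok {m} {k′} m₀≤m m<m₀+n (bracket lower upper) with m≤n⇒∃[o]m+o≡n m₀≤m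
    ... | i , refl = test-sound (2 + m) (quotient m) (quotient (suc m)) (A (2 + m)) (C (2 + m))
      (allBelow-sound (check m₀) ok (<⇒<′ (+-cancelˡ-< m₀ i n m<m₀+n)))
      (≤-trans (/-monoˡ-≤ (11 ^ m) {{m^n≢0 11 m}} lower) (≤-reflexive (m*n/n≡m (suc k′) (11 ^ m) {{m^n≢0 11 m}})))
      (≤-trans (≤-reflexive (sym (m*n/n≡m (suc k′) (11 ^ suc m) {{m^n≢0 11 (suc m)}})))
        (/-monoˡ-≤ (11 ^ suc m) {{m^n≢0 11 (suc m)}} (<⇒≤ upper)))

  -- Large degrees

  -- The weights are a = α s and b = B k, the growth rate is B k + γ s, and the costs are
  -- E s, s and D s, for every s = m + 2 with m ≥ m₀.  From N s ≤ k it follows that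
  -- (1 + γ s/(B k)) ^ k is at least the s-th power of (1 + γ/(B N)) ^ N.  The latter
  -- exceeds (13/11) ^ 2, the factor by which k ^ 2 may grow from one s to the next.
  -- The remaining tests start these inductions and keep the smaller terms in check.
  module Asymptotic (α B γ N D E F m₀ j₀ : ℕ) .{{B≢0 : NonZero B}} .{{_ : NonZero N}} .{{_ : NonZero j₀}}
    (budget-test : T (γ + (E + (1 + (D + 0))) ≤ᵇ α))
    (start-test  : T (N * (2 + m₀) * 11 ^ m₀ ≤ᵇ 13 ^ m₀))
    (six-test    : T (6 ≤ᵇ 2 + m₀))
    (γ-test      : T (γ ≤ᵇ F * N))
    (α-test      : T (2 * α ≤ᵇ B))
    (in-test     : T (j₀ * α ≤ᵇ 1 * 2 ^ pred j₀))
    (j₀-test     : T (j₀ ≤ᵇ N))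
    (rate-test   : T (169 * (B * N) ^ N ≤ᵇ 121 * (B * N + γ) ^ N))
    (out-test    : T ((B + F) * 169 ^ suc m₀ * ((B * N) ^ N) ^ (2 + m₀) ≤ᵇ
                      E * (2 + m₀) * ((B * N + γ) ^ N) ^ (2 + m₀) * 121 ^ suc m₀))
    (α-B-test    : T (30 * α ≤ᵇ 11 * B))
    (star-test   : T (α * (α * (2 + m₀)) ^ (2 + m₀) ≤ᵇ D * B ^ (2 + m₀) * (2 + m₀) !))
    where

    -- N s ≤ (13/11) ^ m for s = m + 2, hence N s ≤ k.
    linear-≤ : ∀ i → N * (2 + (m₀ + i)) * 11 ^ (m₀ + i) ≤ 13 ^ (m₀ + i)
    linear-≤ zero rewrite +-identityʳ m₀ = ≤ᵇ⇒≤ (N * (2 + m₀) * 11 ^ m₀) (13 ^ m₀) start-test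
    linear-≤ (suc i) rewrite +-suc m₀ i = begin
      N * (3 + m) * (11 * 11 ^ m)     ≡⟨ r₁ N (3 + m) (11 ^ m) ⟩
      11 * (3 + m) * (N * 11 ^ m)     ≤⟨ *-monoˡ-≤ (N * 11 ^ m) grow ⟩
      13 * (2 + m) * (N * 11 ^ m)     ≡⟨ r₂ N (2 + m) (11 ^ m) ⟩
      13 * (N * (2 + m) * 11 ^ m)     ≤⟨ *-monoʳ-≤ 13 (linear-≤ i) ⟩
      13 * 13 ^ m                     ∎
      where
      m = m₀ + i
      r₁ : ∀ a b c → a * b * (11 * c) ≡ 11 * b * (a * c)
      r₁ = solve-∀
      r₂ : ∀ a b c → 13 * b * (a * c) ≡ 13 * (a * b * c)
      r₂ = solve-∀
      grow : 11 * (3 + m) ≤ 13 * (2 + m)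
      grow with m≤n⇒∃[o]m+o≡n (≤-trans (≤ᵇ⇒≤ 6 (2 + m₀) six-test) (+-monoʳ-≤ 2 (m≤m+n m₀ i)))
      ... | d , 6+d≡2+m = begin
        11 * suc (2 + m)    ≡⟨ cong (λ x → 11 * suc x) 6+d≡2+m ⟨
        11 * (7 + d)        ≤⟨ m≤m+n _ (1 + 2 * d) ⟩
        11 * (7 + d) + (1 + 2 * d) ≡⟨ expand d ⟩
        13 * (6 + d)        ≡⟨ cong (13 *_) 6+d≡2+m ⟩
        13 * (2 + m)        ∎
        where
        expand : ∀ d → 11 * (7 + d) + (1 + 2 * d) ≡ 13 * (6 + d)
        expand = solve-∀

    power-mono : ∀ X Y P Q → 169 * P ≤ 121 * Q → (m s : ℕ) → X * 169 ^ m * P ^ s ≤ Y * Q ^ s * 121 ^ m →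
                 ∀ i → X * 169 ^ (m + i) * P ^ (s + i) ≤ Y * Q ^ (s + i) * 121 ^ (m + i)
    power-mono X Y P Q rate m s base zero rewrite +-identityʳ m | +-identityʳ s = base
    power-mono X Y P Q rate m s base (suc i) rewrite +-suc m i | +-suc s i = begin
      X * (169 * 169 ^ (m + i)) * (P * P ^ (s + i))
        ≡⟨ r₁ X 169 (169 ^ (m + i)) P (P ^ (s + i)) ⟩
      169 * P * (X * 169 ^ (m + i) * P ^ (s + i))
        ≤⟨ *-mono-≤ rate (power-mono X Y P Q rate m s base i) ⟩
      121 * Q * (Y * Q ^ (s + i) * 121 ^ (m + i))
        ≡⟨ r₂ Y 121 (121 ^ (m + i)) Q (Q ^ (s + i)) ⟩
      Y * (Q * Q ^ (s + i)) * (121 * 121 ^ (m + i)) ∎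
      where
      r₁ : ∀ X c C P R → X * (c * C) * (P * R) ≡ c * P * (X * C * R)
      r₁ = solve-∀
      r₂ : ∀ Y d D Q R → d * Q * (Y * R * D) ≡ Y * (Q * R) * (d * D)
      r₂ = solve-∀

    -- The star term: (α s / B) ^ s / s! is at most D / α.
    star-mono : ∀ i → α * (α * (2 + (m₀ + i))) ^ (2 + (m₀ + i)) ≤ D * B ^ (2 + (m₀ + i)) * (2 + (m₀ + i)) !
    star-mono zero rewrite +-identityʳ m₀ = ≤ᵇ⇒≤ (α * (α * (2 + m₀)) ^ (2 + m₀)) (D * B ^ (2 + m₀) * (2 + m₀) !) star-test
    star-mono (suc i) rewrite +-suc m₀ i = step (2 + (m₀ + i)) (star-mono i)
      where
      -- From s to s + 1 the sides grow by α (s + 1) (1 + 1/s) ^ s and by B (s + 1), where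
      -- (1 + 1/s) ^ s ≤ 30/11 ≤ B/α.
      step : ∀ s .{{_ : NonZero s}} → α * (α * s) ^ s ≤ D * B ^ s * s ! →
             α * (α * suc s) ^ suc s ≤ D * B ^ suc s * suc s !
      step s ih = *-cancelˡ-≤ 11 (begin
        11 * (α * (α * suc s) ^ suc s)
          ≡⟨ cong (λ z → 11 * (α * (α * suc s * z))) (^-distrib-* s α (suc s)) ⟩
        11 * (α * (α * suc s * (α ^ s * suc s ^ s)))
          ≡⟨ r₁ α (suc s) (α ^ s) (suc s ^ s) ⟩
        α * suc s * α * α ^ s * (11 * suc s ^ s)
          ≤⟨ *-monoʳ-≤ (α * suc s * α * α ^ s) (euler-bound s) ⟩
        α * suc s * α * α ^ s * (30 * s ^ s)
          ≡⟨ r₂ α (suc s) (α ^ s) (s ^ s) ⟩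
        30 * α * suc s * (α * (α ^ s * s ^ s))
          ≡⟨ cong (λ z → 30 * α * suc s * (α * z)) (^-distrib-* s α s) ⟨
        30 * α * suc s * (α * (α * s) ^ s)
          ≤⟨ *-mono-≤ (*-monoˡ-≤ (suc s) (≤ᵇ⇒≤ (30 * α) (11 * B) α-B-test)) ih ⟩
        11 * B * suc s * (D * B ^ s * s !)
          ≡⟨ r₃ B (suc s) D (B ^ s) (s !) ⟩
        11 * (D * (B * B ^ s) * (suc s * s !)) ∎)
        where
        r₁ : ∀ a s p q → 11 * (a * (a * s * (p * q))) ≡ a * s * a * p * (11 * q)
        r₁ = solve-∀
        r₂ : ∀ a s p q → a * s * a * p * (30 * q) ≡ 30 * a * s * (a * (p * q))
        r₂ = solve-∀
        r₃ : ∀ B s D p f → 11 * B * s * (D * p * f) ≡ 11 * (D * (B * p) * (s * f))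
        r₃ = solve-∀

    admissible : ∀ {m k′} → m₀ ≤ m → Log m (suc k′) → Admissible k′ (2 + m)
    admissible {m} {k′} m₀≤m (bracket lower upper) with m≤n⇒∃[o]m+o≡n m₀≤m
    ... | i , refl = Scaled.admissible k′ s (α * s) B (γ * s) (E * s) s (D * s)
      (Scaled.out-from k′ s (α * s) B (γ * s) (E * s) s (D * s) {{B≢0}} {N * s} {{Ns≢0}} Ns≤k out)
      (begin
        2 * (α * s)        ≡⟨ *-assoc 2 α s ⟨
        2 * α * s          ≤⟨ *-mono-≤ (≤ᵇ⇒≤ (2 * α) B α-test) s≤k ⟩
        B * k              ≤⟨ m≤m+n (B * k) (γ * s) ⟩
        B * k + γ * s      ∎)
      (begin
        k * (α * s)        ≡⟨ *-assoc k α s ⟨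
        k * α * s          ≤⟨ *-monoˡ-≤ s (n*c≤e*2^ {j₀} {α} {1} {k}
                                (≤ᵇ⇒≤ (j₀ * α) (1 * 2 ^ pred j₀) in-test) (≤⇒≤′ j₀≤k)) ⟩
        1 * 2 ^ k′ * s     ≡⟨ r₁ (2 ^ k′) s ⟩
        s * 2 ^ k′         ∎)
      (begin
        (k P′ s) * (α * s * (α * s) ^ s)     ≤⟨ *-monoˡ-≤ _ (P′-≤-^ k s) ⟩
        k ^ s * (α * s * (α * s) ^ s)        ≡⟨ r₂ (k ^ s) α s ((α * s) ^ s) ⟩
        s * k ^ s * (α * (α * s) ^ s)        ≤⟨ *-monoʳ-≤ (s * k ^ s) (star-mono i) ⟩
        s * k ^ s * (D * B ^ s * s !)        ≡⟨ r₃ s (k ^ s) D (B ^ s) (s !) ⟩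
        D * s * (B ^ s * k ^ s) * s !        ≡⟨ cong (λ z → D * s * z * s !) (^-distrib-* s B k) ⟨
        D * s * (B * k) ^ s * s !            ≤⟨ *-monoˡ-≤ (s !) (*-monoʳ-≤ (D * s) (^-monoˡ-≤ s (m≤m+n (B * k) (γ * s)))) ⟩
        D * s * (B * k + γ * s) ^ s * s !    ∎)
      (begin
        γ * s + (E * s + (s + (D * s + 0)))  ≡⟨ r₄ γ E D s ⟩
        (γ + (E + (1 + (D + 0)))) * s        ≤⟨ *-monoˡ-≤ s (≤ᵇ⇒≤ (γ + (E + (1 + (D + 0)))) α budget-test) ⟩
        α * s                                ∎)
      where
      k s P Q : ℕ
      k = suc k′
      s = 2 + (m₀ + i)
      P = (B * N) ^ N
      Q = (B * N + γ) ^ N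
      r₁ : ∀ x s → 1 * x * s ≡ s * x
      r₁ = solve-∀
      r₂ : ∀ p a s q → p * (a * s * q) ≡ s * p * (a * q)
      r₂ = solve-∀
      r₃ : ∀ s p D b f → s * p * (D * b * f) ≡ D * s * (b * p) * f
      r₃ = solve-∀
      r₄ : ∀ γ E D s → γ * s + (E * s + (s + (D * s + 0))) ≡ (γ + (E + (1 + (D + 0)))) * s
      r₄ = solve-∀
      Ns≢0 : NonZero (N * s)
      Ns≢0 = m*n≢0 N s
      Ns≤k : N * s ≤ k
      Ns≤k = *-cancelʳ-≤ _ _ (11 ^ m) {{m^n≢0 11 m}} (≤-trans (linear-≤ i) lower)
      s≤k : s ≤ k
      s≤k = ≤-trans (m≤n*m s N) Ns≤k
      j₀≤k : j₀ ≤ k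
      j₀≤k = ≤-trans (≤ᵇ⇒≤ j₀ N j₀-test) (≤-trans (m≤m*n N s) Ns≤k)
      β≤ : B * k + γ * s ≤ (B + F) * k
      β≤ = begin
        B * k + γ * s         ≤⟨ +-monoʳ-≤ (B * k) (*-monoˡ-≤ s (≤ᵇ⇒≤ γ (F * N) γ-test)) ⟩
        B * k + F * N * s     ≡⟨ cong (λ z → B * k + z) (*-assoc F N s) ⟩
        B * k + F * (N * s)   ≤⟨ +-monoʳ-≤ (B * k) (*-monoʳ-≤ F Ns≤k) ⟩
        B * k + F * k         ≡⟨ *-distribʳ-+ k B F ⟨
        (B + F) * k           ∎
      k²≤ : k * k * 121 ^ suc m ≤ 169 ^ suc m
      k²≤ = begin
        k * k * 121 ^ suc m                     ≡⟨ cong (k * k *_) (^-distrib-* (suc m) 11 11) ⟩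
        k * k * (11 ^ suc m * 11 ^ suc m)       ≡⟨ r k (11 ^ suc m) ⟩
        k * 11 ^ suc m * (k * 11 ^ suc m)       ≤⟨ *-mono-≤ (<⇒≤ upper) (<⇒≤ upper) ⟩
        13 ^ suc m * 13 ^ suc m                 ≡⟨ ^-distrib-* (suc m) 13 13 ⟨
        169 ^ suc m                             ∎
        where
        r : ∀ k p → k * k * (p * p) ≡ k * p * (k * p)
        r = solve-∀
      -- With j = N s the compound is the s-th power of a constant.
      power : ∀ x → (x * s) ^ (N * s) ≡ s ^ (N * s) * (x ^ N) ^ s
      power x = trans (^-distrib-* (N * s) x s) (trans (*-comm (x ^ (N * s)) (s ^ (N * s)))
        (cong (s ^ (N * s) *_) (sym (^-*-assoc x N s))))
      main : k * (B * k + γ * s) * P ^ s ≤ E * s * Q ^ s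
      main = *-cancelʳ-≤ _ _ (121 ^ suc m) {{m^n≢0 121 (suc m)}} (begin
        k * (B * k + γ * s) * P ^ s * 121 ^ suc m
          ≤⟨ *-monoˡ-≤ (121 ^ suc m) (*-monoˡ-≤ (P ^ s) (*-monoʳ-≤ k β≤)) ⟩
        k * ((B + F) * k) * P ^ s * 121 ^ suc m
          ≡⟨ r k (B + F) (P ^ s) (121 ^ suc m) ⟩
        (B + F) * (k * k * 121 ^ suc m) * P ^ s
          ≤⟨ *-monoˡ-≤ (P ^ s) (*-monoʳ-≤ (B + F) k²≤) ⟩
        (B + F) * 169 ^ suc m * P ^ s
          ≤⟨ power-mono (B + F) (E * (2 + m₀)) P Q (≤ᵇ⇒≤ (169 * P) (121 * Q) rate-test) (suc m₀) (2 + m₀)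
               (≤ᵇ⇒≤ ((B + F) * 169 ^ suc m₀ * P ^ (2 + m₀)) (E * (2 + m₀) * Q ^ (2 + m₀) * 121 ^ suc m₀) out-test) i ⟩
        E * (2 + m₀) * Q ^ s * 121 ^ suc m
          ≤⟨ *-monoˡ-≤ (121 ^ suc m) (*-monoˡ-≤ (Q ^ s) (*-monoʳ-≤ E (+-monoʳ-≤ 2 (m≤m+n m₀ i)))) ⟩
        E * s * Q ^ s * 121 ^ suc m ∎)
        where
        r : ∀ k b p q → k * (b * k) * p * q ≡ b * (k * k * q) * p
        r = solve-∀
      out : k * (B * k + γ * s) * (B * (N * s)) ^ (N * s) ≤ E * s * (B * (N * s) + γ * s) ^ (N * s)
      out = begin
        k * (B * k + γ * s) * (B * (N * s)) ^ (N * s)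
          ≡⟨ cong (λ x → k * (B * k + γ * s) * x ^ (N * s)) (*-assoc B N s) ⟨
        k * (B * k + γ * s) * (B * N * s) ^ (N * s)
          ≡⟨ cong (k * (B * k + γ * s) *_) (power (B * N)) ⟩
        k * (B * k + γ * s) * (s ^ (N * s) * P ^ s)
          ≡⟨ swap (k * (B * k + γ * s)) (s ^ (N * s)) (P ^ s) ⟩
        s ^ (N * s) * (k * (B * k + γ * s) * P ^ s)
          ≤⟨ *-monoʳ-≤ (s ^ (N * s)) main ⟩
        s ^ (N * s) * (E * s * Q ^ s)
          ≡⟨ swap (E * s) (s ^ (N * s)) (Q ^ s) ⟨
        E * s * (s ^ (N * s) * Q ^ s)
          ≡⟨ cong (E * s *_) (power (B * N + γ)) ⟨
        E * s * ((B * N + γ) * s) ^ (N * s)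
          ≡⟨ cong (λ x → E * s * x ^ (N * s)) (collect B N γ s) ⟩
        E * s * (B * (N * s) + γ * s) ^ (N * s) ∎
        where
        swap : ∀ x y z → x * (y * z) ≡ y * (x * z)
        swap = solve-∀
        collect : ∀ B N γ s → (B * N + γ) * s ≡ B * (N * s) + γ * s
        collect = solve-∀

  -- The ratio k a / b is 13 for s < 30, 2.6 + 0.31 s for 30 ≤ s < 58, and 11 s / 30 from
  -- s = 58 on.  For moderate s there is little room: larger values increase the star term
  -- and smaller ones the out term.
  module Below30 = Range (λ _ → 1300) (λ _ → 1140) 100 115 1 43
  module Below58 = Range (λ s → 2600 + 310 * s) (λ s → 1100 + 310 * s) 1000 1060 10 430
  module From58  = Asymptotic 1100 3000 1005 199 48 46 6 56 16 _ _ _ _ _ _ _ _ _ _ _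

  admissible : ∀ {m k′} → 17 ≤ m → Log m (suc k′) → Admissible k′ (2 + m)
  admissible {m} 17≤m log with m <? 28 | m <? 56
  ... | yes m<28 | _        = Below30.admissible 17 11 _ 17≤m m<28 log
  ... | no m≮28  | yes m<56 = Below58.admissible 28 28 _ (≮⇒≥ m≮28) m<56 log
  ... | no _     | no m≮56  = From58.admissible (≮⇒≥ m≮56) log

  -- Existence of the logarithm

  -- Five steps suffice to double k, as 2 ≤ (13/11) ^ 5.
  log-exceeds : ∀ k → ∃ λ j → k * 11 ^ j < 13 ^ j
  log-exceeds zero          = 0 , s≤s z≤n
  log-exceeds (suc zero)    = 1 , ≤ᵇ⇒≤ 12 13 _
  log-exceeds (suc (suc k)) with log-exceeds (suc k)
  ... | j , k<  = 5 + j , (begin-strict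
    suc (suc k) * 11 ^ (5 + j)            ≤⟨ *-monoˡ-≤ (11 ^ (5 + j)) (s≤s (m≤n+m (suc k) k)) ⟩
    (suc k + suc k) * 11 ^ (5 + j)        ≡⟨ cong₂ _*_ (double (suc k)) (^-distribˡ-+-* 11 5 j) ⟩
    2 * suc k * (11 ^ 5 * 11 ^ j)         ≡⟨ r 2 (suc k) (11 ^ 5) (11 ^ j) ⟩
    2 * 11 ^ 5 * (suc k * 11 ^ j)         ≤⟨ *-monoˡ-≤ (suc k * 11 ^ j) (≤ᵇ⇒≤ (2 * 11 ^ 5) (13 ^ 5) _) ⟩
    13 ^ 5 * (suc k * 11 ^ j)             <⟨ *-monoʳ-< (13 ^ 5) k< ⟩
    13 ^ 5 * 13 ^ j                       ≡⟨ ^-distribˡ-+-* 13 5 j ⟨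
    13 ^ (5 + j)                          ∎)
    where
    double : ∀ x → x + x ≡ 2 * x
    double = solve-∀
    r : ∀ a b c d → a * b * (c * d) ≡ a * c * (b * d)
    r = solve-∀

  log-exists : ∀ k .{{_ : NonZero k}} → ∃ λ m → Log m k
  log-exists k with log-exceeds k
  ... | j , k< with minimum (λ i → k * 11 ^ i <? 13 ^ i) j k<
  ... | zero  , least , _   = contradiction least (≤⇒≯ (≤-trans (>-nonZero⁻¹ k) (≤-reflexive (sym (*-identityʳ k)))))
  ... | suc m , least , low = m , bracket (≮⇒≥ (λ lt → 1+n≰n (low m lt))) least

  -- A lower bound on the logarithm m of k from tests for a smaller k₀.
  log-≥ : ∀ {m k k₀ i} → Log m k → k₀ ≤ k → T (allBelow (λ j → 13 ^ j ≤ᵇ k₀ * 11 ^ j) i) → i ≤ suc m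
  log-≥ {m} {k} {k₀} {i} (bracket _ upper) k₀≤k ok with i ≤? suc m
  ... | yes i≤1+m = i≤1+m
  ... | no i≰1+m  = contradiction upper (≤⇒≯ (≤-trans
    (≤ᵇ⇒≤ (13 ^ suc m) (k₀ * 11 ^ suc m) (allBelow-sound (λ j → 13 ^ j ≤ᵇ k₀ * 11 ^ j) ok (<⇒<′ (≰⇒> i≰1+m))))
    (*-monoˡ-≤ (11 ^ suc m) k₀≤k)))

-- The logarithm

reciprocals-mono : ∀ a {p q} → p ≤ q → reciprocals a p ℚ.≤ reciprocals a q
reciprocals-mono a p≤q = go (≤⇒≤′ p≤q)
  where
  go : ∀ {p q} → p ≤′ q → reciprocals a p ℚ.≤ reciprocals a q
  go ≤′-refl        = ℚ.≤-refl
  go (≤′-step {q} p≤q) = ℚ.≤-trans (go p≤q) (reciprocals-snoc a q)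

-- The Riemann sum of 1/t from 11 to 13 with mesh 1/19.  The integral, ln (13/11), is
-- only slightly larger than 1/6.
sixth : + 1 / 6 ℚ.≤ reciprocals (11 * 19) (2 * 19)
sixth = toWitness {a? = + 1 / 6 ℚ.≤? reciprocals (11 * 19) (2 * 19)} _

-- The Riemann sum from 11 ^ m to 13 ^ m with mesh 1/(19 c) is at least m / 6: split the
-- range at 11 ^ (m - i) 13 ^ i.
sixths : ∀ m c .{{_ : NonZero c}} → ∃ λ p → 19 * c * 11 ^ m + p ≡ 19 * c * 13 ^ m ×
         multiple m (+ 1 / 6) ℚ.≤ reciprocals (19 * c * 11 ^ m) p
sixths zero    c = 0 , +-identityʳ _ , ℚ.≤-refl
sixths (suc m) c {{c≢0}} =
  let p , reach , bound = sixths m (13 * c) {{m*n≢0 13 c}} in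
  2 * 19 * d + p ,
  trans (cong (λ x → x + (2 * 19 * d + p)) (sym start))
    (trans (r₁ d p) (trans (cong (_+ p) (r₂ c (11 ^ m))) (trans reach (r₃ c (13 ^ m))))) ,
  ℚ.≤-trans
    (ℚ.+-mono-≤ (ℚ.≤-trans sixth (refine-lower (11 * 19) (2 * 19) d))
                (ℚ.≤-trans bound (ℚ.≤-reflexive (cong (λ x → reciprocals x p) (sym (trans (r₄ d) (r₂ c (11 ^ m))))))))
    (ℚ.≤-reflexive (trans (sym (reciprocals-+ (11 * 19 * d) (2 * 19 * d) p))
      (cong (λ x → reciprocals x (2 * 19 * d + p)) start)))
  where
  d = c * 11 ^ m
  instance
    d≢0 : NonZero d
    d≢0 = m*n≢0 c (11 ^ m) {{c≢0}} {{m^n≢0 11 m}}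
  start : 11 * 19 * d ≡ 19 * c * (11 * 11 ^ m)
  start = r₀ c (11 ^ m)
    where
    r₀ : ∀ c q → 11 * 19 * (c * q) ≡ 19 * c * (11 * q)
    r₀ = solve-∀
  r₁ : ∀ d p → 11 * 19 * d + (2 * 19 * d + p) ≡ 13 * 19 * d + p
  r₁ = solve-∀
  r₂ : ∀ c q → 13 * 19 * (c * q) ≡ 19 * (13 * c) * q
  r₂ = solve-∀
  r₃ : ∀ c q → 19 * (13 * c) * q ≡ 19 * c * (13 * q)
  r₃ = solve-∀
  r₄ : ∀ d → 11 * 19 * d + 2 * 19 * d ≡ 13 * 19 * d
  r₄ = solve-∀

reciprocals-≤-riemann : ∀ k .{{_ : NonZero k}} a .{{_ : NonZero a}} {p} → a + p ≤ k * a → ∀ n →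
                        reciprocals a p ℚ.≤ + 1 / suc n ℚ.+ riemann k (suc n)
reciprocals-≤-riemann k a@(suc M) {p} a+p≤ka n =
  ℚ.≤-trans (reciprocals-mono a p≤) (riemann-compare k M n)
  where
  p≤ : p ≤ pred k * a
  p≤ = +-cancelˡ-≤ a _ _ (≤-trans a+p≤ka (≤-reflexive (cong (_* a) (sym (suc-pred k)))))

-- If k ≥ (13/11) ^ m, then ln k ≥ m / 6, stated for the approximations of ln k.  The mesh
-- 1/(19 11 ^ m) serves to bound one Riemann sum, and comparison transfers it to the others.
log-≤-riemann : ∀ {m} k .{{_ : NonZero k}} → Log m k → ∀ n →
                multiple m (+ 1 / 6) ℚ.≤ + 1 / suc n ℚ.+ riemann k (suc n)
log-≤-riemann {m} k (bracket lower _) n =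
  let p , reach , bound = sixths m 1 in
  ℚ.≤-trans bound (reciprocals-≤-riemann k (19 * 1 * 11 ^ m) {{m*n≢0 19 (11 ^ m) {{_}} {{m^n≢0 11 m}}}} (begin
    19 * 1 * 11 ^ m + p    ≡⟨ reach ⟩
    19 * 1 * 13 ^ m        ≤⟨ *-monoʳ-≤ (19 * 1) lower ⟩
    19 * 1 * (k * 11 ^ m)  ≡⟨ swap k (11 ^ m) ⟩
    k * (19 * 1 * 11 ^ m)  ∎) n)
  where
  open ≤-Reasoning
  swap : ∀ k q → 19 * 1 * (k * q) ≡ k * (19 * 1 * q)
  swap = solve-∀

multiple-mono : ∀ m {p q} → p ℚ.≤ q → multiple m p ℚ.≤ multiple m q
multiple-mono zero    p≤q = ℚ.≤-refl
multiple-mono (suc m) p≤q = ℚ.+-mono-≤ p≤q (multiple-mono m p≤q)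

multiple-+ : ∀ m p q → multiple m (p ℚ.+ q) ≡ multiple m p ℚ.+ multiple m q
multiple-+ zero    p q = refl
multiple-+ (suc m) p q = trans (cong (p ℚ.+ q ℚ.+_) (multiple-+ m p q)) (interchange p q (multiple m p) (multiple m q))
  where
  open +-*-Solver
  interchange : ∀ a b c d → a ℚ.+ b ℚ.+ (c ℚ.+ d) ≡ a ℚ.+ c ℚ.+ (b ℚ.+ d)
  interchange = solve 4 (λ a b c d → a :+ b :+ (c :+ d) := a :+ c :+ (b :+ d)) refl

multiple-comm : ∀ i j q → multiple i (multiple j q) ≡ multiple j (multiple i q)
multiple-comm i zero    q = zeros i
  where
  zeros : ∀ i → multiple i 0ℚ ≡ 0ℚ
  zeros zero    = refl
  zeros (suc i) = trans (ℚ.+-identityˡ _) (zeros i)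
multiple-comm i (suc j) q = trans (multiple-+ i q (multiple j q)) (cong (multiple i q ℚ.+_) (multiple-comm i j q))

/1-≤-multiple : ∀ {z j} → z ℤ.≤ + j → z / 1 ℚ.≤ multiple j (+ 1 / 1)
/1-≤-multiple {z} {j} z≤j = ℚ.toℚᵘ-cancel-≤ (begin
  toℚᵘ (z / 1)                  ≃⟨ ℚ.toℚᵘ-fromℚᵘ (ℚᵘ.mkℚᵘ z 0) ⟩
  ℚᵘ.mkℚᵘ z 0                   ≤⟨ ℚᵘ.*≤* (ℤ.*-monoʳ-≤-nonNeg (+ 1) z≤j) ⟩
  ℚᵘ.mkℚᵘ (+ j) 0               ≃⟨ multiple-mkℚᵘ j 0 ⟨
  toℚᵘ (multiple j (+ 1 / 1))   ∎)
  where open ℚᵘ.≤-Reasoning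

difference-≤ : ∀ {i j d} → i ≤ j + d → + i - + j ℤ.≤ + d
difference-≤ {i} {j} {d} i≤j+d = begin
  + i - + j          ≡⟨ ℤ.m-n≡m⊖n i j ⟩
  i ℤ.⊖ j            ≤⟨ ℤ.⊖-monoˡ-≤ j i≤j+d ⟩
  (j + d) ℤ.⊖ j      ≡⟨ ℤ.⊖-≥ (m≤m+n j d) ⟩
  + (j + d ∸ j)      ≡⟨ cong +_ (m+n∸m≡n j d) ⟩
  + d                ∎
  where open ℤ.≤-Reasoning

-- Six times the error 1/(n + 1) is at most 1/(j + 1) for n + 1 ≥ 6 (j + 1).
log-≤-ln : ∀ {m k} .{{_ : NonZero k}} → Log m k → ∀ {z} → z ℤ.≤ + (2 + m) →
           fromℤ z ≤ᴿ 6 · ln k +ᴿ fromℤ (+ 2)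
log-≤-ln {m} {k} log {z} z≤2+m ε 0<ε =
  let j , 1/j<ε = archimedean ε 0<ε
      N = pred (suc j * 6)
  in N , λ n N≤n → let r = riemann k (suc n) in begin-strict
    z / 1
      ≤⟨ /1-≤-multiple z≤2+m ⟩
    1ℚ ℚ.+ (1ℚ ℚ.+ multiple m 1ℚ)
      ≡⟨ ℚ.+-assoc 1ℚ 1ℚ (multiple m 1ℚ) ⟨
    + 2 / 1 ℚ.+ multiple m 1ℚ
      ≡⟨ cong (+ 2 / 1 ℚ.+_) (multiple-comm 6 m (+ 1 / 6)) ⟨
    + 2 / 1 ℚ.+ multiple 6 (multiple m (+ 1 / 6))
      ≤⟨ ℚ.+-monoʳ-≤ (+ 2 / 1) (multiple-mono 6 (log-≤-riemann k log n)) ⟩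
    + 2 / 1 ℚ.+ multiple 6 (+ 1 / suc n ℚ.+ r)
      ≡⟨ cong (+ 2 / 1 ℚ.+_) (multiple-+ 6 (+ 1 / suc n) r) ⟩
    + 2 / 1 ℚ.+ (multiple 6 (+ 1 / suc n) ℚ.+ multiple 6 r)
      ≤⟨ ℚ.+-monoʳ-≤ (+ 2 / 1) (ℚ.+-monoˡ-≤ (multiple 6 r) (multiple-mono 6 (1/-antitone N≤n))) ⟩
    + 2 / 1 ℚ.+ (multiple 6 (+ 1 / suc N) ℚ.+ multiple 6 r)
      ≡⟨ cong (λ q → + 2 / 1 ℚ.+ (q ℚ.+ multiple 6 r)) (multiple-1/ j 6) ⟩
    + 2 / 1 ℚ.+ (+ 1 / suc j ℚ.+ multiple 6 r)
      <⟨ ℚ.+-monoʳ-< (+ 2 / 1) (ℚ.+-monoˡ-< (multiple 6 r) 1/j<ε) ⟩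
    + 2 / 1 ℚ.+ (ε ℚ.+ multiple 6 r)
      ≡⟨ rotate (+ 2 / 1) ε (multiple 6 r) ⟩
    multiple 6 r ℚ.+ + 2 / 1 ℚ.+ ε ∎
  where
  open ℚ.≤-Reasoning
  rotate : ∀ a b c → a ℚ.+ (b ℚ.+ c) ≡ c ℚ.+ a ℚ.+ b
  rotate = solve 3 (λ a b c → a :+ (b :+ c) := c :+ a :+ b) refl
    where
    open +-*-Solver

-- The bound

module _ {n : ℕ} (G : Graph n) where
  open Graph G

  χ₂-least : ∀ {l} → DynamicColorable G l → χ₂ G ≤ l
  χ₂-least = proj₂ (proj₂ (χ₂-minimum G)) _

  χ-colorable : Colorable G (χ G)
  χ-colorable = proj₁ (proj₂ (χ-minimum G))

  edge⇒2-colors : ∀ {l u v} → u ~ v → Colorable G l → 2 ≤ l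
  edge⇒2-colors {zero}        {u} u~v (c , _) = case c u of λ ()
  edge⇒2-colors {suc zero}    {u} {v} u~v (c , proper) = contradiction (only (c u) (c v)) (proper u v u~v)
    where
    only : ∀ (i j : Fin 1) → i ≡ j
    only zero zero = refl
  edge⇒2-colors {suc (suc l)} u~v _ = s≤s (s≤s z≤n)

-- With an edge, two of the colors of a dynamic coloring are paid for by χ.
χ₂-≤-edge : ∀ {n} (G : Graph n) {k} .{{_ : NonZero k}} → Regular G k → ∀ {d} →
            DynamicColorable G (2 + d) → χ₂ G ≤ χ G + d
χ₂-≤-edge {zero}  G reg {d} _ = ≤-trans (χ₂-least G {0} ((λ ()) , (λ ()) , λ ())) z≤n
χ₂-≤-edge {suc n} G reg {d} colorable =
  let u , v~u = neighbor G reg zero in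
  ≤-trans (χ₂-least G colorable) (+-monoˡ-≤ d (edge⇒2-colors G v~u (χ-colorable G)))

-- The number e of FewColors: k ≤ e 2 ^ (k - 2) holds with e = 1 from k = 4 on.  In both
-- definitions, k = k′ + 2.
excess : ℕ → ℕ
excess k′ = if k′ <ᵇ 2 then 2 else 1

-- The second part ensures k + e ≤ m + 2 for the logarithm m of k.
few-test : ℕ → Bool
few-test k′ = (2 + k′ ≤ᵇ excess k′ * 2 ^ k′) ∧
  allBelow (λ j → 13 ^ j ≤ᵇ (2 + k′) * 11 ^ j) (suc k′ + excess k′)

χ₂-≤ : ∀ {n m k} .{{_ : NonZero k}} (G : Graph n) → Regular G k → Log m k → χ₂ G ≤ χ G + (2 + m)
χ₂-≤ {k = suc zero} G reg log =
  let c , proper = χ-colorable G in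
  ≤-trans
    (χ₂-least G (c , proper , λ v 2≤d → contradiction (≤-trans 2≤d (≤-reflexive (reg v))) λ { (s≤s ()) }))
    (m≤m+n (χ G) _)
χ₂-≤ {m = m} {suc (suc k′)} G reg log with k′ <? 17
... | yes k′<17 =
  let small , large-log = Equivalence.to (T-∧ {2 + k′ ≤ᵇ e * 2 ^ k′})
                            (allBelow-sound few-test {k′} {17} _ (<⇒<′ k′<17)) in
  ≤-trans (χ₂-≤-edge G reg (subst (DynamicColorable G) (cong (λ x → 2 + (2 + k′ + x)) (+-identityʳ e))
    (FewColors.dynamicColorable G reg e (≤ᵇ⇒≤ (2 + k′) (e * 2 ^ k′) small))))
    (+-monoʳ-≤ (χ G) (s≤s (log-≥ log ≤-refl large-log)))
  where
  e = excess k′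
... | no k′≮17 = χ₂-least G
  (InOut.dynamicColorable G reg a b β (2 + m) eₒ eᵢ eₛ {{β≢0}} out-bound in-bound star-bound balance (χ-colorable G))
  where
  17≤m : 17 ≤ m
  17≤m = s≤s⁻¹ (log-≥ {k₀ = 19} {18} log (s≤s (s≤s (≮⇒≥ k′≮17))) _)
  open Admissible (admissible 17≤m log)

theorem3 : (k : ℕ) .{{_ : NonZero k}} {n : ℕ} (G : Graph n) → Regular G k →
    fromℤ (+ χ₂ G - + χ G) ≤ᴿ 6 · ln k +ᴿ fromℤ (+ 2)
theorem3 k G reg =
  let m , log = log-exists k in
  log-≤-ln log (difference-≤ (χ₂-≤ G reg log))
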